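{- Let $n,k,s$ be positive integers with $n \geq \max\{2^{8}s^{3/2} \log_2^{3/2}(sk),\ 8 s^2\}$. Then the sequence $(f_1,\ldots,f_s)$ with $f_i = i\cdot n^{k-1}$ for $i\in[s]$ is satisfying; that is, whenever $\mathcal F_1,\ldots,\mathcal F_s\subset [n]^k$ satisfy $|\mathcal F_i|> i\, n^{k-1}$ for every $i\in[s]$, there exist pairwise disjoint $F_1\in\mathcal F_1,\ldots,F_s\in\mathcal F_s$.
   Context: $[n]=\{1,\ldots,n\}$ and $[n]^k$ is the set of all $k$-tuples $(x_1,\ldots,x_k)$ with $x_j\in[n]$. A tuple $(x_1,\ldots,x_k)$ is identified with the $k$-element set $\{(1,x_1),\ldots,(k,x_k)\}\subset[k]\times[n]$; thus two tuples $x,y$ are disjoint iff $x_j\neq y_j$ for all $j\in[k]$. For families $\mathcal F_1,\ldots,\mathcal F_s\subset[n]^k$, a rainbow matching (cross-matching) is a choice of pairwise disjoint $F_1\in\mathcal F_1,\ldots,F_s\in\mathcal F_s$. A sequence of reals $(f_1,\ldots,f_s)$ is called satisfying (for the given $n,k$) if for all families $\mathcal F_1,\ldots,\mathcal F_s\subset[n]^k$ with $|\mathcal F_i|>f_i$ for each $i\in[s]$, the families contain a rainbow matching. -}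

module Defs where

open import Data.Nat using (ℕ; _+_; _*_; _∸_; _^_; _≤_; _<_)
open import Data.Fin using (Fin; toℕ)
open import Data.Vec using (Vec; lookup)
open import Data.List using (List; length)
open import Data.List.Membership.Propositional using (_∈_)
open import Data.List.Relation.Unary.Unique.Propositional using (Unique)
open import Data.Product using (Σ; _×_)
open import Relation.Binary.PropositionalEquality using (_≡_; _≢_)

Tuple : ℕ → ℕ → Set
Tuple n k = Vec (Fin n) k

Disjoint : ∀ {n k} → Tuple n k → Tuple n k → Set
Disjoint {k = k} x y = (j : Fin k) → lookup x j ≢ lookup y j

record Family (n k : ℕ) : Set where
  field
    elems  : List (Tuple n k)
    unique : Unique elems

open Family public

size : ∀ {n k} → Family n k → ℕ
size F = length (elems F)

RainbowMatching : ∀ {n k s} → (Fin s → Family n k) → Set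
RainbowMatching {n} {k} {s} ℱ =
  Σ (Fin s → Tuple n k) λ F →
    ((i : Fin s) → F i ∈ elems (ℱ i)) ×
    ((i j : Fin s) → i ≢ j → Disjoint (F i) (F j))

-- The real inequality  n ≥ 2^8 · s^{3/2} · (log₂(s k))^{3/2},  stated exactly over ℕ:
-- equivalently 2^16 s^3 L^3 ≤ n^2 with L = log₂(sk) ≥ 0, i.e. every nonnegative rational
-- r = p/q < L (⇔ 2^p < (sk)^q) satisfies 2^16 s^3 p^3 ≤ n^2 q^3.
LogCond : ℕ → ℕ → ℕ → Set
LogCond n k s = (p q : ℕ) → 1 ≤ q → 2 ^ p < (s * k) ^ q →
  2 ^ 16 * s ^ 3 * p ^ 3 ≤ n ^ 2 * q ^ 3

{-# OPTIONS --safe #-}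

-- Tuples are encoded as k-subsets of [k] × [n], so that a family contains at most n ^ (k ∸ ∣ S ∣)
-- sets through S. Put m = s β with 2 ^ (β ∸ 1) ≤ s k < 2 ^ β and R = 8 m; the hypotheses give
-- 4 R³ ≤ n². A family is r-spread if at most a fraction r ^ (- ∣ S ∣) of its members contain S.
--
-- (1) If S has maximal size subject to ∣ 𝓐 ∣ ≤ R ^ ∣ S ∣ ∣ 𝓐(S) ∣, the link 𝓐(S) is R-spread, and
--     ∣ S ∣ ≤ 2 as soon as ∣ 𝓐 ∣ > n ^ (k ∸ 1) / 4.
-- (2) The cores S_i can be chosen pairwise disjoint. Going through the families in order, a vertex of
--     degree at least 3 s n ^ (k ∸ 2), if there is one, becomes the stem of the current family and is
--     deleted from all later ones; the i-th family loses at most (i ∸ 1) n ^ (k ∸ 1) members in this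
--     way. A family without a stem has small degrees, so it gets a core avoiding all stems and the
--     previous cores; afterwards the links of the stems are still large enough to get one too.
-- (3) Deleting the at most 3 s vertices of stems and cores leaves the links R/2-spread. Colour the
--     vertices with s colours at random. A colour class is a union of β random sets of density 1/m,
--     and each of them halves the mean size of what remains to be covered of a member of a
--     4m-spread family. Hence with positive probability, for every i, class i contains a member
--     of the i-th link.
module Submission where

open import Defs
open import Algebra.Properties.CommutativeSemigroup using (interchange; x∙yz≈y∙xz)
open import Data.Bool using (Bool; true; false)
open import Data.Empty using (⊥-elim)
open import Data.Fin using (Fin; zero; suc; toℕ; _≟_; _↑ˡ_; _↑ʳ_; combine)
open import Data.Fin.Properties using () renaming (any? to anyFin?)
open import Data.Fin.Subset
  using (Subset; Side; inside; outside; _∪_; _∩_; _─_; ∁; ∣_∣; _⊆_; _∈_; _∉_; ⁅_⁆; ⊥; Empty)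
open import Data.Fin.Subset.Properties
open import Data.List using (List; []; _∷_; _++_; length; map; filter; allFin; cartesianProductWith)
open import Data.List.Membership.Propositional using (find) renaming (_∈_ to _∈ₗ_; _∉_ to _∉ₗ_)
open import Data.List.Membership.Propositional.Properties
  using (∈-filter⁻; ∈-map∘filter⁻; ∈-map⁺; ∈-map⁻; ∈-++⁺ˡ; ∈-++⁺ʳ; ∈-++⁻; ∈-∃++; ∈-allFin;
         ∈-cartesianProductWith⁺)
open import Data.List.Properties
  using (length-map; map-∘; length-filter; filter-all; filter-none; length-++; map-tabulate; map-++;
         length-tabulate)
open import Data.List.Relation.Unary.All as All using (All; all?)
open import Data.List.Relation.Unary.All.Properties using (map⁺; ¬Any⇒All¬)
open import Data.List.Relation.Unary.AllPairs using ([]; _∷_)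
open import Data.List.Relation.Unary.Any using (here; there; any?)
open import Data.List.Relation.Unary.Unique.Propositional using (Unique)
open import Data.Nat hiding (_≟_)
open import Data.Nat.ListAction using (sum)
open import Data.Nat.ListAction.Properties using (sum-++)
open import Data.Nat.Properties hiding (_≟_)
open import Data.Nat.Tactic.RingSolver using (solve-∀)
open import Data.Product using (∃; _×_; _,_; proj₁; proj₂)
open import Data.Sum using (_⊎_; inj₁; inj₂; [_,_]′)
open import Data.Vec as Vec using ([]; _∷_; lookup; splitAt)
open import Function using (_∘_; id)
open import Relation.Binary.PropositionalEquality hiding ([_])
open import Relation.Nullary
open import Relation.Unary using (Pred; Decidable)

open import Algebra.Properties.CommutativeMonoid.Sum +-0-commutativeMonoid
  using (∑-comm; sum-cong-≗) renaming (sum to ∑ᶠ)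

private variable
  X Y Z : Set
  n k N : ℕ

-- Weighted sums over subsets

∑ : List X → (X → ℕ) → ℕ
∑ xs f = sum (map f xs)

∑-mono : ∀ (xs : List X) {f g : X → ℕ} → (∀ {x} → x ∈ₗ xs → f x ≤ g x) → ∑ xs f ≤ ∑ xs g
∑-mono []       f≤g = z≤n
∑-mono (x ∷ xs) f≤g = +-mono-≤ (f≤g (here refl)) (∑-mono xs (f≤g ∘ there))

∑-+ : ∀ (xs : List X) (f g : X → ℕ) → ∑ xs (λ x → f x + g x) ≡ ∑ xs f + ∑ xs g
∑-+ []       f g = refl
∑-+ (x ∷ xs) f g = trans (cong (f x + g x +_) (∑-+ xs f g)) (interchange +-commutativeSemigroup (f x) (g x) _ _)

∑-*ˡ : ∀ (xs : List X) c (f : X → ℕ) → ∑ xs (λ x → c * f x) ≡ c * ∑ xs f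
∑-*ˡ []       c f = sym (*-zeroʳ c)
∑-*ˡ (x ∷ xs) c f = trans (cong (c * f x +_) (∑-*ˡ xs c f)) (sym (*-distribˡ-+ c (f x) _))

∑-const : ∀ (xs : List X) c → ∑ xs (λ _ → c) ≡ length xs * c
∑-const []       c = refl
∑-const (x ∷ xs) c = cong (c +_) (∑-const xs c)

∑-map : ∀ (f : Y → X) (xs : List Y) (g : X → ℕ) → ∑ (map f xs) g ≡ ∑ xs (g ∘ f)
∑-map f xs g = cong sum (sym (map-∘ xs))

⟦_⟧ : ∀ {p} {P : Set p} → Dec P → ℕ
⟦ yes _ ⟧ = 1
⟦ no  _ ⟧ = 0

⟦⟧-mono : ∀ {p q} {P : Set p} {Q : Set q} (P? : Dec P) (Q? : Dec Q) →
          (P → Q) → ⟦ P? ⟧ ≤ ⟦ Q? ⟧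
⟦⟧-mono (no _)  _       _   = z≤n
⟦⟧-mono (yes _) (yes _) _   = s≤s z≤n
⟦⟧-mono (yes p) (no ¬q) p⇒q = contradiction (p⇒q p) ¬q

⟦⟧-yes : ∀ {p} {P : Set p} (P? : Dec P) → P → ⟦ P? ⟧ ≡ 1
⟦⟧-yes (yes _) _ = refl
⟦⟧-yes (no ¬p) p = contradiction p ¬p

⟦⟧-no : ∀ {p} {P : Set p} (P? : Dec P) → ¬ P → ⟦ P? ⟧ ≡ 0
⟦⟧-no (yes p) ¬p = contradiction p ¬p
⟦⟧-no (no _)  _  = refl

⟦⟧≤1 : ∀ {p} {P : Set p} (P? : Dec P) → ⟦ P? ⟧ ≤ 1
⟦⟧≤1 (yes _) = ≤-refl
⟦⟧≤1 (no _)  = z≤n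

length-filter≡∑ : ∀ {p} {P : Pred X p} (P? : Decidable P) xs →
                  length (filter P? xs) ≡ ∑ xs (λ x → ⟦ P? x ⟧)
length-filter≡∑ P? []       = refl
length-filter≡∑ P? (x ∷ xs) with P? x
... | yes _ = cong suc (length-filter≡∑ P? xs)
... | no  _ = length-filter≡∑ P? xs

minimiser : ∀ {p} {P : Pred X p} (P? : Decidable P) (f : X → ℕ) xs →
            (∃ λ x → x ∈ₗ xs × P x × (∀ {y} → y ∈ₗ xs → P y → f x ≤ f y)) ⊎
            (∀ {y} → y ∈ₗ xs → ¬ P y)
minimiser P? f []       = inj₂ λ ()
minimiser P? f (x ∷ xs) with P? x | minimiser P? f xs
... | no ¬px | inj₂ none = inj₂ λ { (here refl) → ¬px ; (there y∈) → none y∈ }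
... | no ¬px | inj₁ (z , z∈ , pz , min) =
  inj₁ (z , there z∈ , pz ,
        λ { (here refl) py → contradiction py ¬px ; (there y∈) → min y∈ })
... | yes px | inj₂ none =
  inj₁ (x , here refl , px ,
        λ { (here refl) _ → ≤-refl ; (there y∈) py → contradiction py (none y∈) })
... | yes px | inj₁ (z , z∈ , pz , min) with ≤-total (f x) (f z)
...   | inj₁ fx≤fz = inj₁ (x , here refl , px ,
          λ { (here refl) _ → ≤-refl ; (there y∈) py → ≤-trans fx≤fz (min y∈ py) })
...   | inj₂ fz≤fx = inj₁ (z , there z∈ , pz ,
          λ { (here refl) _ → fz≤fx ; (there y∈) → min y∈ })

-- Up to the factor (a + b) ^ N, the expectation of g over a random subset
-- containing each point independently with probability a / (a + b).
𝔼 : ℕ → ℕ → (Subset N → ℕ) → ℕ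
𝔼 {zero}  a b g = g []
𝔼 {suc N} a b g = a * 𝔼 a b (λ W → g (inside ∷ W)) + b * 𝔼 a b (λ W → g (outside ∷ W))

module _ (a b : ℕ) where

  𝔼-mono : {f g : Subset N → ℕ} → (∀ W → f W ≤ g W) → 𝔼 a b f ≤ 𝔼 a b g
  𝔼-mono {zero}  f≤g = f≤g []
  𝔼-mono {suc N} f≤g = +-mono-≤ (*-monoʳ-≤ a (𝔼-mono (f≤g ∘ (inside ∷_))))
                                (*-monoʳ-≤ b (𝔼-mono (f≤g ∘ (outside ∷_))))

  𝔼-cong : {f g : Subset N → ℕ} → (∀ W → f W ≡ g W) → 𝔼 a b f ≡ 𝔼 a b g
  𝔼-cong f≡g = ≤-antisym (𝔼-mono (≤-reflexive ∘ f≡g)) (𝔼-mono (≤-reflexive ∘ sym ∘ f≡g))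

  𝔼-+ : (f g : Subset N → ℕ) → 𝔼 a b (λ W → f W + g W) ≡ 𝔼 a b f + 𝔼 a b g
  𝔼-+ {zero}  f g = refl
  𝔼-+ {suc N} f g = trans
    (cong₂ (λ u v → a * u + b * v) (𝔼-+ (f ∘ (inside ∷_)) (g ∘ (inside ∷_)))
                                   (𝔼-+ (f ∘ (outside ∷_)) (g ∘ (outside ∷_))))
    (lem a b _ _ _ _)
    where
    lem : ∀ a b p q r s → a * (p + q) + b * (r + s) ≡ (a * p + b * r) + (a * q + b * s)
    lem = solve-∀

  𝔼-*ˡ : ∀ c (f : Subset N → ℕ) → 𝔼 a b (λ W → c * f W) ≡ c * 𝔼 a b f
  𝔼-*ˡ {zero}  c f = refl
  𝔼-*ˡ {suc N} c f = trans
    (cong₂ (λ u v → a * u + b * v) (𝔼-*ˡ c (f ∘ (inside ∷_))) (𝔼-*ˡ c (f ∘ (outside ∷_))))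
    (lem a b c _ _)
    where
    lem : ∀ a b c p q → a * (c * p) + b * (c * q) ≡ c * (a * p + b * q)
    lem = solve-∀

  𝔼-const : ∀ N c → 𝔼 {N} a b (λ _ → c) ≡ (a + b) ^ N * c
  𝔼-const zero    c = sym (+-identityʳ c)
  𝔼-const (suc N) c = trans (cong (λ u → a * u + b * u) (𝔼-const N c)) (lem a b c _)
    where
    lem : ∀ a b c p → a * (p * c) + b * (p * c) ≡ (a + b) * p * c
    lem = solve-∀

-- A point avoids both random sets with probability (t + b)/(1 + t + b) · b/(t + b) = b/(1 + t + b),
-- so the union is a random set of density (1 + t)/(1 + t + b). The factor `(t + b) ^ N` is the
-- second normalisation on the left.
𝔼-∪ : ∀ t b (h : Subset N → ℕ) →
      𝔼 1 (t + b) (λ W₁ → 𝔼 t b (λ W₂ → h (W₁ ∪ W₂))) ≡ (t + b) ^ N * 𝔼 (1 + t) b h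
𝔼-∪ {zero}  t b h = sym (+-identityʳ _)
𝔼-∪ {suc N} t b h = begin
  1 * 𝔼 1 (t + b) (λ W₁ → t * I W₁ + b * I W₁) + (t + b) * 𝔼 1 (t + b) (λ W₁ → t * I W₁ + b * O W₁)
    ≡⟨ cong₂ (λ u v → 1 * u + (t + b) * v) (split I I) (split I O) ⟩
  1 * (t * 𝔼 1 (t + b) I + b * 𝔼 1 (t + b) I) + (t + b) * (t * 𝔼 1 (t + b) I + b * 𝔼 1 (t + b) O)
    ≡⟨ cong₂ (λ u v → 1 * (t * u + b * u) + (t + b) * (t * u + b * v))
             (𝔼-∪ t b (h ∘ (inside ∷_))) (𝔼-∪ t b (h ∘ (outside ∷_))) ⟩
  1 * (t * (m * p) + b * (m * p)) + (t + b) * (t * (m * p) + b * (m * q))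
    ≡⟨ lem t b m p q ⟩
  (t + b) * m * ((1 + t) * p + b * q) ∎
  where
  open ≡-Reasoning
  I O : Subset N → ℕ
  I W₁ = 𝔼 t b (λ W₂ → h (inside ∷ (W₁ ∪ W₂)))
  O W₁ = 𝔼 t b (λ W₂ → h (outside ∷ (W₁ ∪ W₂)))
  m p q : ℕ
  m = (t + b) ^ N
  p = 𝔼 (1 + t) b (h ∘ (inside ∷_))
  q = 𝔼 (1 + t) b (h ∘ (outside ∷_))
  split : ∀ f g → 𝔼 1 (t + b) (λ W → t * f W + b * g W) ≡ t * 𝔼 1 (t + b) f + b * 𝔼 1 (t + b) g
  split f g = trans (𝔼-+ 1 (t + b) (λ W → t * f W) (λ W → b * g W))
                    (cong₂ _+_ (𝔼-*ˡ 1 (t + b) t f) (𝔼-*ˡ 1 (t + b) b g))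
  lem : ∀ t b m p q → 1 * (t * (m * p) + b * (m * p)) + (t + b) * (t * (m * p) + b * (m * q))
                ≡ (t + b) * m * ((1 + t) * p + b * q)
  lem = solve-∀

∑⊆ : Subset N → (Subset N → ℕ) → ℕ
∑⊆ []            g = g []
∑⊆ (inside  ∷ Z) g = ∑⊆ Z (λ T → g (inside ∷ T)) + ∑⊆ Z (λ T → g (outside ∷ T))
∑⊆ (outside ∷ Z) g = ∑⊆ Z (λ T → g (outside ∷ T))

∑⊆-mono : ∀ (Z : Subset N) {f g : Subset N → ℕ} → (∀ T → f T ≤ g T) → ∑⊆ Z f ≤ ∑⊆ Z g
∑⊆-mono []            f≤g = f≤g []
∑⊆-mono (inside  ∷ Z) f≤g = +-mono-≤ (∑⊆-mono Z (f≤g ∘ (inside ∷_))) (∑⊆-mono Z (f≤g ∘ (outside ∷_)))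
∑⊆-mono (outside ∷ Z) f≤g = ∑⊆-mono Z (f≤g ∘ (outside ∷_))

∑⊆-*ˡ : ∀ (Z : Subset N) c f → ∑⊆ Z (λ T → c * f T) ≡ c * ∑⊆ Z f
∑⊆-*ˡ []            c f = refl
∑⊆-*ˡ (inside  ∷ Z) c f = trans
  (cong₂ _+_ (∑⊆-*ˡ Z c (f ∘ (inside ∷_))) (∑⊆-*ˡ Z c (f ∘ (outside ∷_))))
  (sym (*-distribˡ-+ c (∑⊆ Z (f ∘ (inside ∷_))) _))
∑⊆-*ˡ (outside ∷ Z) c f = ∑⊆-*ˡ Z c (f ∘ (outside ∷_))

∑⊆-+ : ∀ (Z : Subset N) f g → ∑⊆ Z (λ T → f T + g T) ≡ ∑⊆ Z f + ∑⊆ Z g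
∑⊆-+ []            f g = refl
∑⊆-+ (inside  ∷ Z) f g = trans
  (cong₂ _+_ (∑⊆-+ Z (f ∘ (inside ∷_)) (g ∘ (inside ∷_))) (∑⊆-+ Z (f ∘ (outside ∷_)) (g ∘ (outside ∷_))))
  (interchange +-commutativeSemigroup (∑⊆ Z (f ∘ (inside ∷_))) _ _ _)
∑⊆-+ (outside ∷ Z) f g = ∑⊆-+ Z (f ∘ (outside ∷_)) (g ∘ (outside ∷_))

∑⊆-∑ : ∀ (Z : Subset N) (xs : List X) (f : X → Subset N → ℕ) →
       ∑⊆ Z (λ T → ∑ xs (λ x → f x T)) ≡ ∑ xs (λ x → ∑⊆ Z (f x))
∑⊆-∑ Z []       f = ∑⊆-*ˡ Z 0 (λ _ → 0)
∑⊆-∑ Z (x ∷ xs) f = trans (∑⊆-+ Z (f x) _) (cong (∑⊆ Z (f x) +_) (∑⊆-∑ Z xs f))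

∑⊆-term : ∀ {T Z : Subset N} g → T ⊆ Z → g T ≤ ∑⊆ Z g
∑⊆-term {T = []}          {[]}          g T⊆Z = ≤-refl
∑⊆-term {T = inside ∷ T}  {inside ∷ Z}  g T⊆Z = ≤-trans (∑⊆-term (g ∘ (inside ∷_)) (drop-∷-⊆ T⊆Z)) (m≤m+n _ _)
∑⊆-term {T = outside ∷ T} {inside ∷ Z}  g T⊆Z = ≤-trans (∑⊆-term (g ∘ (outside ∷_)) (drop-∷-⊆ T⊆Z)) (m≤n+m _ _)
∑⊆-term {T = inside ∷ T}  {outside ∷ Z} g T⊆Z with () ← T⊆Z Vec.here
∑⊆-term {T = outside ∷ T} {outside ∷ Z} g T⊆Z = ∑⊆-term (g ∘ (outside ∷_)) (drop-∷-⊆ T⊆Z)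

-- The left side counts the subsets of `Z ∩ H`.
∑⊆-⟦⊆⟧≤2^ : ∀ (Z H : Subset N) → ∑⊆ Z (λ T → ⟦ T ⊆? H ⟧) ≤ 2 ^ ∣ H ∣
∑⊆-⟦⊆⟧≤2^ []           []            = ≤-refl
∑⊆-⟦⊆⟧≤2^ (inside ∷ Z) (inside ∷ H)  = ≤-trans
  (+-mono-≤ (≤-trans (∑⊆-mono Z λ T → ⟦⟧-mono (inside ∷ T ⊆? inside ∷ H) (T ⊆? H) drop-∷-⊆) (∑⊆-⟦⊆⟧≤2^ Z H))
            (≤-trans (∑⊆-mono Z λ T → ⟦⟧-mono (outside ∷ T ⊆? inside ∷ H) (T ⊆? H) drop-∷-⊆) (∑⊆-⟦⊆⟧≤2^ Z H)))
  (≤-reflexive (cong (2 ^ ∣ H ∣ +_) (sym (+-identityʳ _))))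
∑⊆-⟦⊆⟧≤2^ (inside ∷ Z) (outside ∷ H) = ≤-trans
  (+-mono-≤ (≤-trans (∑⊆-mono Z λ T → none T) (≤-reflexive (∑⊆-*ˡ Z 0 (λ _ → 0))))
            (∑⊆-mono Z λ T → ⟦⟧-mono (outside ∷ T ⊆? outside ∷ H) (T ⊆? H) drop-∷-⊆))
  (∑⊆-⟦⊆⟧≤2^ Z H)
  where
  none : ∀ T → ⟦ inside ∷ T ⊆? outside ∷ H ⟧ ≤ 0
  none T with inside ∷ T ⊆? outside ∷ H
  ... | no _ = z≤n
  ... | yes sub with () ← sub Vec.here
∑⊆-⟦⊆⟧≤2^ (outside ∷ Z) (s ∷ H)      = ≤-trans
  (∑⊆-mono Z λ T → ⟦⟧-mono (outside ∷ T ⊆? s ∷ H) (T ⊆? H) drop-∷-⊆)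
  (≤-trans (∑⊆-⟦⊆⟧≤2^ Z H) (^-monoʳ-≤ 2 (∣p∣≤∣x∷p∣ s H)))

-- Pairs (W, T) with T disjoint from W are re-encoded by Z = W ∪ T.
𝔼-∑⊆∁ : ∀ b (g : Subset N → Subset N → ℕ) →
        𝔼 1 b (λ W → ∑⊆ (∁ W) (λ T → g (W ∪ T) T)) ≡
        𝔼 1 b (λ Z → ∑⊆ Z (λ T → b ^ ∣ T ∣ * g Z T))
𝔼-∑⊆∁ {zero}  b g = sym (+-identityʳ _)
𝔼-∑⊆∁ {suc N} b g = begin
  1 * 𝔼 1 b (λ W → ∑⊆ (∁ W) (λ T → g (inside ∷ (W ∪ T)) (outside ∷ T))) +
  b * 𝔼 1 b (λ W → ∑⊆ (∁ W) (λ T → g (inside ∷ (W ∪ T)) (inside ∷ T)) +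
                   ∑⊆ (∁ W) (λ T → g (outside ∷ (W ∪ T)) (outside ∷ T)))
    ≡⟨ cong (λ u → 1 * L inside outside + b * u) (𝔼-+ 1 b {N} _ _) ⟩
  1 * L inside outside + b * (L inside inside + L outside outside)
    ≡⟨ cong₂ (λ u v → 1 * u + b * v) (ih inside outside) (cong₂ _+_ (ih inside inside) (ih outside outside)) ⟩
  1 * R inside outside + b * (R inside inside + R outside outside)
    ≡⟨ lem b (R inside outside) (R inside inside) (R outside outside) ⟩
  1 * (b * R inside inside + R inside outside) + b * R outside outside
    ≡⟨ cong (λ u → 1 * u + b * R outside outside) (sym collect) ⟩
  1 * 𝔼 1 b (λ Z → ∑⊆ Z (λ T → b * b ^ ∣ T ∣ * g (inside ∷ Z) (inside ∷ T)) +
                   ∑⊆ Z (λ T → b ^ ∣ T ∣ * g (inside ∷ Z) (outside ∷ T))) + b * R outside outside ∎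
  where
  open ≡-Reasoning
  L R : Side → Side → ℕ
  L s s′ = 𝔼 1 b (λ W → ∑⊆ (∁ W) (λ T → g (s ∷ (W ∪ T)) (s′ ∷ T)))
  R s s′ = 𝔼 1 b (λ Z → ∑⊆ Z (λ T → b ^ ∣ T ∣ * g (s ∷ Z) (s′ ∷ T)))
  ih : ∀ s s′ → L s s′ ≡ R s s′
  ih s s′ = 𝔼-∑⊆∁ b (λ Z T → g (s ∷ Z) (s′ ∷ T))
  lem : ∀ b x y z → 1 * x + b * (y + z) ≡ 1 * (b * y + x) + b * z
  lem = solve-∀
  ∑⊆-cong : ∀ (Z : Subset N) {f g : Subset N → ℕ} → (∀ T → f T ≡ g T) → ∑⊆ Z f ≡ ∑⊆ Z g
  ∑⊆-cong Z f≡g = ≤-antisym (∑⊆-mono Z (≤-reflexive ∘ f≡g)) (∑⊆-mono Z (≤-reflexive ∘ sym ∘ f≡g))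
  collect : 𝔼 1 b (λ Z → ∑⊆ Z (λ T → b * b ^ ∣ T ∣ * g (inside ∷ Z) (inside ∷ T)) +
                         ∑⊆ Z (λ T → b ^ ∣ T ∣ * g (inside ∷ Z) (outside ∷ T)))
            ≡ b * R inside inside + R inside outside
  collect = trans (𝔼-+ 1 b {N} _ _) (cong (_+ R inside outside) (trans
    (𝔼-cong 1 b {N} λ Z → trans (∑⊆-cong Z λ T → *-assoc b (b ^ ∣ T ∣) (g (inside ∷ Z) (inside ∷ T))) (∑⊆-*ˡ Z b _))
    (𝔼-*ˡ 1 b {N} b _)))

-- Fragments and the covering of spread families

x∈p─q⇒x∉q : ∀ {x} (p q : Subset N) → x ∈ p ─ q → x ∉ q
x∈p─q⇒x∉q (_ ∷ p) (outside ∷ q) (Vec.there x∈) (Vec.there x∈q) = x∈p─q⇒x∉q p q x∈ x∈q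
x∈p─q⇒x∉q (_ ∷ p) (inside ∷ q)  (Vec.there x∈) (Vec.there x∈q) = x∈p─q⇒x∉q p q x∈ x∈q

x∈p∪q∧x∉q⇒x∈p : ∀ {x} (p q : Subset N) → x ∈ p ∪ q → x ∉ q → x ∈ p
x∈p∪q∧x∉q⇒x∈p p q x∈ x∉q = [ id , (λ x∈q → contradiction x∈q x∉q) ]′ (x∈p∪q⁻ p q x∈)

∪-least : ∀ {p q r : Subset N} → p ⊆ r → q ⊆ r → p ∪ q ⊆ r
∪-least {p = p} {q} p⊆r q⊆r x∈ = [ p⊆r , q⊆r ]′ (x∈p∪q⁻ p q x∈)

p⊆q∪p─q : ∀ (p q : Subset N) → p ⊆ q ∪ (p ─ q)
p⊆q∪p─q p q {x} x∈p with x ∈? q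
... | yes x∈q = x∈p∪q⁺ (inj₁ x∈q)
... | no  x∉q = x∈p∪q⁺ (inj₂ (x∈p∧x∉q⇒x∈p─q x∈p x∉q))

p⊆q∧∣q∣≤∣p∣⇒q⊆p : ∀ {p q : Subset N} → p ⊆ q → ∣ q ∣ ≤ ∣ p ∣ → q ⊆ p
p⊆q∧∣q∣≤∣p∣⇒q⊆p {p = p} p⊆q ∣q∣≤∣p∣ {x} x∈q with x ∈? p
... | yes x∈p = x∈p
... | no  x∉p = contradiction (p⊂q⇒∣p∣<∣q∣ (p⊆q , x , x∈q , x∉p)) (≤⇒≯ ∣q∣≤∣p∣)

^-distribʳ-* : ∀ m n o → (n * o) ^ m ≡ n ^ m * o ^ m
^-distribʳ-* zero    n o = refl
^-distribʳ-* (suc m) n o = trans (cong (n * o *_) (^-distribʳ-* m n o)) ([m*n]*[o*p]≡[m*o]*[n*p] n o _ _)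

-- 2 ^ e ≥ 1 + e at e = 2t − h, multiplied by 2 ^ N.
1+2t≤ : ∀ {N h} t → h ≤ N → 2 ^ N * (1 + 2 * t) ≤ 4 ^ t * 2 ^ (N ∸ h) + 2 ^ N * h
1+2t≤ {N} {h} t h≤N = begin
  2 ^ N * (1 + 2 * t)             ≡⟨ cong (_* (1 + 2 * t)) split ⟩
  c * 2 ^ h * (1 + 2 * t)         ≡⟨ *-assoc c _ _ ⟩
  c * (2 ^ h * (1 + 2 * t))       ≤⟨ *-monoʳ-≤ c core ⟩
  c * (4 ^ t + 2 ^ h * h)         ≡⟨ lem c (4 ^ t) (2 ^ h) h ⟩
  4 ^ t * c + c * 2 ^ h * h       ≡⟨ cong (λ u → 4 ^ t * c + u * h) (sym split) ⟩
  4 ^ t * c + 2 ^ N * h           ∎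
  where
  open ≤-Reasoning
  c = 2 ^ (N ∸ h)
  split : 2 ^ N ≡ c * 2 ^ h
  split = trans (cong (2 ^_) (sym (m∸n+n≡m h≤N))) (^-distribˡ-+-* 2 (N ∸ h) h)
  lem : ∀ c x y h → c * (x + y * h) ≡ x * c + c * y * h
  lem = solve-∀
  1+e≤2^e : ∀ e → 1 + e ≤ 2 ^ e
  1+e≤2^e zero    = ≤-refl
  1+e≤2^e (suc e) = ≤-trans (s≤s (1+e≤2^e e))
    (+-mono-≤ (m^n>0 2 e) (≤-reflexive (sym (+-identityʳ _))))
  core : 2 ^ h * (1 + 2 * t) ≤ 4 ^ t + 2 ^ h * h
  core with h ≤? 2 * t
  -- For h > 2t the last summand on the right suffices.
  ... | no h≰ = ≤-trans (*-monoʳ-≤ (2 ^ h) (≰⇒> h≰)) (m≤n+m _ _)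
  ... | yes h≤ = begin
    2 ^ h * (1 + 2 * t)                  ≡⟨ cong (λ u → 2 ^ h * (1 + u)) (sym (m∸n+n≡m h≤)) ⟩
    2 ^ h * (1 + (e + h))                ≡⟨ lem′ (2 ^ h) e h ⟩
    2 ^ h * (1 + e) + 2 ^ h * h          ≤⟨ +-monoˡ-≤ _ (*-monoʳ-≤ (2 ^ h) (1+e≤2^e e)) ⟩
    2 ^ h * 2 ^ e + 2 ^ h * h            ≡⟨ cong (_+ _) (sym (^-distribˡ-+-* 2 h e)) ⟩
    2 ^ (h + e) + 2 ^ h * h              ≡⟨ cong (λ u → 2 ^ u + 2 ^ h * h) (m+[n∸m]≡n h≤) ⟩
    2 ^ (2 * t) + 2 ^ h * h              ≡⟨ cong (_+ _) (sym (^-*-assoc 2 2 t)) ⟩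
    4 ^ t + 2 ^ h * h                    ∎
    where
    e = 2 * t ∸ h
    lem′ : ∀ x e h → x * (1 + (e + h)) ≡ x * (1 + e) + x * h
    lem′ = solve-∀

cnt : List (Subset N) → Subset N → ℕ
cnt 𝓐 S = length (filter (S ⊆?_) 𝓐)

Spread : ℕ → List (Subset N) → Set
Spread r 𝓐 = ∀ T → r ^ ∣ T ∣ * cnt 𝓐 T ≤ length 𝓐

module _ (𝓐 : List (Subset N)) where

  Smallest : Subset N → Set
  Smallest Z = (∃ λ H → H ∈ₗ 𝓐 × H ⊆ Z × (∀ {K} → K ∈ₗ 𝓐 → K ⊆ Z → ∣ H ∣ ≤ ∣ K ∣)) ⊎
               (∀ {K} → K ∈ₗ 𝓐 → ¬ K ⊆ Z)

  smallest : ∀ Z → Smallest Z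
  smallest Z = minimiser (_⊆? Z) ∣_∣ 𝓐

  module _ (W : Subset N) where

    -- The size bound passes on to the smallest member of `𝓐` inside `W` and the fragment, so that
    -- the error term of `1+2t≤` can be charged to `∣ A ∣`.
    Candidate : Subset N → Subset N → Set
    Candidate A H = H ⊆ A ∪ W × ∣ H ∣ ≤ ∣ A ∣

    bestCandidate : ∀ A →
      (∃ λ H → H ∈ₗ 𝓐 × Candidate A H × (∀ {K} → K ∈ₗ 𝓐 → Candidate A K → ∣ H ─ W ∣ ≤ ∣ K ─ W ∣)) ⊎
      (∀ {K} → K ∈ₗ 𝓐 → ¬ Candidate A K)
    bestCandidate A =
      minimiser (λ H → (H ⊆? A ∪ W) ×-dec (∣ H ∣ ≤? ∣ A ∣)) (λ H → ∣ H ─ W ∣) 𝓐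

    -- The part of a candidate that `W` leaves uncovered, as small as possible. A member of `𝓐` is a
    -- candidate for itself, so the default `⊥` can only occur for sets outside `𝓐`.
    fragment : Subset N → Subset N
    fragment A = [ (λ best → proj₁ best ─ W) , (λ _ → ⊥) ]′ (bestCandidate A)

    fragment-best : ∀ {A} → A ∈ₗ 𝓐 →
      ∃ λ H → H ∈ₗ 𝓐 × Candidate A H × fragment A ≡ H ─ W ×
              (∀ {K} → K ∈ₗ 𝓐 → Candidate A K → ∣ fragment A ∣ ≤ ∣ K ─ W ∣)
    fragment-best {A} A∈ with bestCandidate A
    ... | inj₁ (H , H∈ , cand , min) = H , H∈ , cand , refl , min
    ... | inj₂ none = ⊥-elim (none A∈ (p⊆p∪q W , ≤-refl))

    fragment-⊆ : ∀ A → fragment A ⊆ A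
    fragment-⊆ A with bestCandidate A
    ... | inj₁ (H , _ , (H⊆ , _) , _) = λ x∈ →
      x∈p∪q∧x∉q⇒x∈p A W (H⊆ (p─q⊆p H W x∈)) (x∈p─q⇒x∉q H W x∈)
    ... | inj₂ _ = ⊥⊆

    fragment-⊆∁ : ∀ A → fragment A ⊆ ∁ W
    fragment-⊆∁ A with bestCandidate A
    ... | inj₁ (H , _) = λ x∈ → x∉p⇒x∈∁p (x∈p─q⇒x∉q H W x∈)
    ... | inj₂ _ = ⊥⊆

    fragments : List (Subset N)
    fragments = map fragment 𝓐

  -- The main term on the right of `1+2t≤`, cut off to `T` inside `H` and `A`. It sees `W` only
  -- through `Z`, hence can be summed over all splittings of `Z` into `W` and `T`.
  weightOf : ∀ {Z} → Smallest Z → Subset N → Subset N → ℕ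
  weightOf (inj₁ (H , _)) T A = ⟦ T ⊆? H ⟧ * (4 ^ ∣ T ∣ * 2 ^ (N ∸ ∣ H ∣)) * ⟦ T ⊆? A ⟧
  weightOf (inj₂ _)       T A = 0

  weight : Subset N → Subset N → Subset N → ℕ
  weight Z = weightOf (smallest Z)

  -- With Z = W ∪ T, T the fragment of A, the smallest member of 𝓐 inside Z
  -- was itself a candidate, so minimality of T forces it to contain T.
  1+2∣fragment∣≤ : ∀ W {A} → A ∈ₗ 𝓐 →
    2 ^ N * (1 + 2 * ∣ fragment W A ∣) ≤
    ∑⊆ (∁ W) (λ T → weight (W ∪ T) T A) + 2 ^ N * ∣ A ∣
  1+2∣fragment∣≤ W {A} A∈ = ≤-trans main
    (+-monoˡ-≤ _ (∑⊆-term (λ T → weight (W ∪ T) T A) (fragment-⊆∁ W A)))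
    where
    T = fragment W A
    main : 2 ^ N * (1 + 2 * ∣ T ∣) ≤ weight (W ∪ T) T A + 2 ^ N * ∣ A ∣
    main with H , H∈ , (H⊆A∪W , ∣H∣≤∣A∣) , T≡ , min ← fragment-best W A∈
         with H⊆Z ← subst (λ U → H ⊆ W ∪ U) (sym T≡) (p⊆q∪p─q H W)
         with smallest (W ∪ T)
    ... | inj₂ none = ⊥-elim (none H∈ H⊆Z)
    ... | inj₁ (H₀ , H₀∈ , H₀⊆Z , ∣H₀∣≤) = begin
      2 ^ N * (1 + 2 * ∣ T ∣)                                ≤⟨ 1+2t≤ ∣ T ∣ (∣p∣≤n H₀) ⟩
      c + 2 ^ N * ∣ H₀ ∣                                     ≤⟨ +-monoʳ-≤ c (*-monoʳ-≤ (2 ^ N) ∣H₀∣≤∣A∣) ⟩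
      c + 2 ^ N * ∣ A ∣                                      ≡⟨ cong (_+ 2 ^ N * ∣ A ∣) (sym weight≡) ⟩
      ⟦ T ⊆? H₀ ⟧ * c * ⟦ T ⊆? A ⟧ + 2 ^ N * ∣ A ∣            ∎
      where
      open ≤-Reasoning
      c = 4 ^ ∣ T ∣ * 2 ^ (N ∸ ∣ H₀ ∣)
      ∣H₀∣≤∣A∣ : ∣ H₀ ∣ ≤ ∣ A ∣
      ∣H₀∣≤∣A∣ = ≤-trans (∣H₀∣≤ H∈ H⊆Z) ∣H∣≤∣A∣
      H₀⊆A∪W : H₀ ⊆ A ∪ W
      H₀⊆A∪W = ⊆-trans H₀⊆Z (∪-least (q⊆p∪q A W) (⊆-trans (fragment-⊆ W A) (p⊆p∪q W)))
      H₀─W⊆T : H₀ ─ W ⊆ T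
      H₀─W⊆T x∈ = [ (λ x∈W → contradiction x∈W (x∈p─q⇒x∉q H₀ W x∈)) , id ]′
                   (x∈p∪q⁻ W T (H₀⊆Z (p─q⊆p H₀ W x∈)))
      T⊆H₀ : T ⊆ H₀
      T⊆H₀ = ⊆-trans (p⊆q∧∣q∣≤∣p∣⇒q⊆p H₀─W⊆T (min H₀∈ (H₀⊆A∪W , ∣H₀∣≤∣A∣))) (p─q⊆p H₀ W)
      weight≡ : ⟦ T ⊆? H₀ ⟧ * c * ⟦ T ⊆? A ⟧ ≡ c
      weight≡ rewrite ⟦⟧-yes (T ⊆? H₀) T⊆H₀ | ⟦⟧-yes (T ⊆? A) (fragment-⊆ W A) =
        trans (*-identityʳ _) (+-identityʳ _)

  -- Let `H` be the smallest member inside `Z`. Spreadness gives (4b)^|T| `cnt 𝓐 T` ≤ `length 𝓐`, so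
  -- each `T ⊆ H` contributes at most 2^(N - |H|) `length 𝓐`, and there are at most 2^|H| such `T`.
  ∑⊆-weight≤ : ∀ {b r} → 4 * b ≤ r → Spread r 𝓐 → ∀ Z →
    ∑⊆ Z (λ T → b ^ ∣ T ∣ * ∑ 𝓐 (weight Z T)) ≤ 2 ^ N * length 𝓐
  ∑⊆-weight≤ {b} {r} 4b≤r spread Z with smallest Z
  ... | inj₂ _ = ≤-trans (∑⊆-mono Z λ T → ≤-reflexive (zero-term (b ^ ∣ T ∣)))
                         (≤-trans (≤-reflexive (∑⊆-*ˡ Z 0 (λ _ → 0))) z≤n)
    where
    zero-term : ∀ c → c * ∑ 𝓐 (λ _ → 0) ≡ 0
    zero-term c = trans (cong (c *_) (trans (∑-const 𝓐 0) (*-zeroʳ (length 𝓐)))) (*-zeroʳ c)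
  ... | inj₁ (H , _) = begin
    ∑⊆ Z (λ T → b ^ ∣ T ∣ * ∑ 𝓐 (λ A → ⟦ T ⊆? H ⟧ * (4 ^ ∣ T ∣ * e) * ⟦ T ⊆? A ⟧))  ≤⟨ ∑⊆-mono Z term ⟩
    ∑⊆ Z (λ T → e * L * ⟦ T ⊆? H ⟧)                      ≡⟨ ∑⊆-*ˡ Z (e * L) _ ⟩
    e * L * ∑⊆ Z (λ T → ⟦ T ⊆? H ⟧)                      ≤⟨ *-monoʳ-≤ (e * L) (∑⊆-⟦⊆⟧≤2^ Z H) ⟩
    e * L * 2 ^ ∣ H ∣                                    ≡⟨ lem e L (2 ^ ∣ H ∣) ⟩
    e * 2 ^ ∣ H ∣ * L                                    ≡⟨ cong (_* L) (sym (^-distribˡ-+-* 2 (N ∸ ∣ H ∣) ∣ H ∣)) ⟩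
    2 ^ (N ∸ ∣ H ∣ + ∣ H ∣) * L                          ≡⟨ cong (λ u → 2 ^ u * L) (m∸n+n≡m (∣p∣≤n H)) ⟩
    2 ^ N * L                                            ∎
    where
    open ≤-Reasoning
    e = 2 ^ (N ∸ ∣ H ∣)
    L = length 𝓐
    lem : ∀ x y z → x * y * z ≡ x * z * y
    lem = solve-∀
    lem′ : ∀ x i y e c → x * (i * (y * e) * c) ≡ i * e * (y * x * c)
    lem′ = solve-∀
    lem″ : ∀ i e l → i * e * l ≡ e * l * i
    lem″ = solve-∀
    term : ∀ T → b ^ ∣ T ∣ * ∑ 𝓐 (λ A → ⟦ T ⊆? H ⟧ * (4 ^ ∣ T ∣ * e) * ⟦ T ⊆? A ⟧)
               ≤ e * L * ⟦ T ⊆? H ⟧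
    term T = begin
      b ^ t * ∑ 𝓐 (λ A → i * (4 ^ t * e) * ⟦ T ⊆? A ⟧)   ≡⟨ cong (b ^ t *_) (∑-*ˡ 𝓐 (i * (4 ^ t * e)) _) ⟩
      b ^ t * (i * (4 ^ t * e) * ∑ 𝓐 (λ A → ⟦ T ⊆? A ⟧)) ≡⟨ cong (λ u → b ^ t * (i * (4 ^ t * e) * u))
                                                              (sym (length-filter≡∑ (T ⊆?_) 𝓐)) ⟩
      b ^ t * (i * (4 ^ t * e) * cnt 𝓐 T)                ≡⟨ lem′ (b ^ t) i (4 ^ t) e (cnt 𝓐 T) ⟩
      i * e * (4 ^ t * b ^ t * cnt 𝓐 T)                  ≡⟨ cong (λ u → i * e * (u * cnt 𝓐 T))
                                                              (sym (^-distribʳ-* t 4 b)) ⟩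
      i * e * ((4 * b) ^ t * cnt 𝓐 T)                    ≤⟨ *-monoʳ-≤ (i * e) (*-monoˡ-≤ (cnt 𝓐 T) (^-monoˡ-≤ t 4b≤r)) ⟩
      i * e * (r ^ t * cnt 𝓐 T)                          ≤⟨ *-monoʳ-≤ (i * e) (spread T) ⟩
      i * e * L                                          ≡⟨ lem″ i e L ⟩
      e * L * i                                          ∎
      where
      t = ∣ T ∣
      i = ⟦ T ⊆? H ⟧

  -- One random set halves the total size. Averaged over `W`, the weights in `1+2∣fragment∣≤` amount
  -- to at most 2^N per member, which cancels exactly against the summand 1; what remains compares
  -- twice the fragments with the sets themselves.
  𝔼-fragment≤ : ∀ {b r} → 4 * b ≤ r → Spread r 𝓐 →
    𝔼 1 b (λ W → ∑ 𝓐 (λ A → 2 * ∣ fragment W A ∣)) ≤ (1 + b) ^ N * ∑ 𝓐 ∣_∣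
  𝔼-fragment≤ {b} 4b≤r spread = +-cancelˡ-≤ (M * L) _ _ (*-cancelˡ-≤ (2 ^ N) {{m^n≢0 2 N}} (begin
    2 ^ N * (M * L + 𝔼 1 b S)                       ≡⟨ cong (λ u → 2 ^ N * (u + 𝔼 1 b S)) (sym (𝔼-const 1 b N L)) ⟩
    2 ^ N * (𝔼 {N} 1 b (λ _ → L) + 𝔼 1 b S)         ≡⟨ cong (2 ^ N *_) (sym (𝔼-+ 1 b (λ _ → L) S)) ⟩
    2 ^ N * 𝔼 1 b (λ W → L + S W)                   ≡⟨ sym (𝔼-*ˡ 1 b (2 ^ N) (λ W → L + S W)) ⟩
    𝔼 1 b (λ W → 2 ^ N * (L + S W))                 ≤⟨ 𝔼-mono 1 b pointwise ⟩
    𝔼 1 b (λ W → Q W + 2 ^ N * U)                   ≡⟨ 𝔼-+ 1 b Q (λ _ → 2 ^ N * U) ⟩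
    𝔼 1 b Q + 𝔼 {N} 1 b (λ _ → 2 ^ N * U)           ≡⟨ cong₂ _+_ (𝔼-∑⊆∁ b (λ Z T → ∑ 𝓐 (weight Z T)))
                                                                 (𝔼-const 1 b N (2 ^ N * U)) ⟩
    𝔼 1 b (λ Z → ∑⊆ Z (λ T → b ^ ∣ T ∣ * ∑ 𝓐 (weight Z T))) + M * (2 ^ N * U)
      ≤⟨ +-monoˡ-≤ _ (≤-trans (𝔼-mono 1 b (∑⊆-weight≤ 4b≤r spread)) (≤-reflexive (𝔼-const 1 b N _))) ⟩
    M * (2 ^ N * L) + M * (2 ^ N * U)               ≡⟨ lem M (2 ^ N) L U ⟩
    2 ^ N * (M * L + M * U)                         ∎))
    where
    open ≤-Reasoning
    M = (1 + b) ^ N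
    L = length 𝓐
    U = ∑ 𝓐 ∣_∣
    S Q : Subset N → ℕ
    S W = ∑ 𝓐 (λ A → 2 * ∣ fragment W A ∣)
    Q W = ∑⊆ (∁ W) (λ T → ∑ 𝓐 (weight (W ∪ T) T))
    lem : ∀ m c l u → m * (c * l) + m * (c * u) ≡ c * (m * l + m * u)
    lem = solve-∀
    pointwise : ∀ W → 2 ^ N * (L + S W) ≤ Q W + 2 ^ N * U
    pointwise W = begin
      2 ^ N * (L + S W)                                     ≡⟨ cong (λ u → 2 ^ N * (u + S W))
                                                                 (sym (trans (∑-const 𝓐 1) (*-identityʳ L))) ⟩
      2 ^ N * (∑ 𝓐 (λ _ → 1) + S W)                         ≡⟨ cong (2 ^ N *_) (sym (∑-+ 𝓐 _ _)) ⟩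
      2 ^ N * ∑ 𝓐 (λ A → 1 + 2 * ∣ fragment W A ∣)          ≡⟨ sym (∑-*ˡ 𝓐 (2 ^ N) _) ⟩
      ∑ 𝓐 (λ A → 2 ^ N * (1 + 2 * ∣ fragment W A ∣))        ≤⟨ ∑-mono 𝓐 (1+2∣fragment∣≤ W) ⟩
      ∑ 𝓐 (λ A → ∑⊆ (∁ W) (λ T → weight (W ∪ T) T A) + 2 ^ N * ∣ A ∣)
                                                            ≡⟨ ∑-+ 𝓐 _ _ ⟩
      ∑ 𝓐 (λ A → ∑⊆ (∁ W) (λ T → weight (W ∪ T) T A)) + ∑ 𝓐 (λ A → 2 ^ N * ∣ A ∣)
                                                            ≡⟨ cong₂ _+_ (sym (∑⊆-∑ (∁ W) 𝓐 (λ A T → weight (W ∪ T) T A)))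
                                                                         (∑-*ˡ 𝓐 (2 ^ N) ∣_∣) ⟩
      Q W + 2 ^ N * U                                       ∎

miss? : ∀ (𝓐 : List (Subset N)) W → Dec (All (λ A → ¬ A ⊆ W) 𝓐)
miss? 𝓐 W = all? (λ A → ¬? (A ⊆? W)) 𝓐

cnt-map-≤ : ∀ (f : Subset N → Subset N) (𝓐 : List (Subset N)) {S T} →
            (∀ {A} → S ⊆ f A → T ⊆ A) → cnt (map f 𝓐) S ≤ cnt 𝓐 T
cnt-map-≤ f 𝓐 {S} {T} imp = begin
  cnt (map f 𝓐) S                    ≡⟨ length-filter≡∑ (S ⊆?_) (map f 𝓐) ⟩
  ∑ (map f 𝓐) (λ A → ⟦ S ⊆? A ⟧)     ≡⟨ ∑-map f 𝓐 _ ⟩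
  ∑ 𝓐 (λ A → ⟦ S ⊆? f A ⟧)           ≤⟨ ∑-mono 𝓐 (λ {A} _ → ⟦⟧-mono (S ⊆? f A) (T ⊆? A) imp) ⟩
  ∑ 𝓐 (λ A → ⟦ T ⊆? A ⟧)             ≡⟨ length-filter≡∑ (T ⊆?_) 𝓐 ⟨
  cnt 𝓐 T                            ∎
  where open ≤-Reasoning

-- Each fragment lies in the set it comes from, and the list keeps repetitions: counts can only drop
-- while the length stays the same.
fragments-spread : ∀ {r} (𝓐 : List (Subset N)) W → Spread r 𝓐 → Spread r (fragments 𝓐 W)
fragments-spread {r = r} 𝓐 W spread T = begin
  r ^ ∣ T ∣ * cnt (fragments 𝓐 W) T   ≤⟨ *-monoʳ-≤ (r ^ ∣ T ∣) (cnt-map-≤ (fragment 𝓐 W) 𝓐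
                                            (λ {A} T⊆ x∈ → fragment-⊆ 𝓐 W A (T⊆ x∈))) ⟩
  r ^ ∣ T ∣ * cnt 𝓐 T                 ≤⟨ spread T ⟩
  length 𝓐                            ≡⟨ length-map (fragment 𝓐 W) 𝓐 ⟨
  length (fragments 𝓐 W)              ∎
  where open ≤-Reasoning

-- If `W₂` covered a fragment `H ─ W₁`, then `W₁ ∪ W₂` would contain the member `H`.
miss-∪≤ : ∀ (𝓐 : List (Subset N)) W₁ W₂ →
          ⟦ miss? 𝓐 (W₁ ∪ W₂) ⟧ ≤ ⟦ miss? (fragments 𝓐 W₁) W₂ ⟧
miss-∪≤ 𝓐 W₁ W₂ = ⟦⟧-mono (miss? 𝓐 (W₁ ∪ W₂)) (miss? (fragments 𝓐 W₁) W₂) λ miss →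
  map⁺ (All.tabulate λ A∈ T⊆W₂ → let H , H∈ , _ , T≡ , _ = fragment-best 𝓐 W₁ A∈ in
    All.lookup miss H∈ (⊆-trans (p⊆q∪p─q H W₁)
      (∪-least (p⊆p∪q W₂) (⊆-trans (subst (_⊆ W₂) T≡ T⊆W₂) (q⊆p∪q W₁ W₂)))))

𝔼-0 : ∀ b (g : Subset N → ℕ) → 𝔼 0 b g ≡ b ^ N * g ⊥
𝔼-0 {zero}  b g = sym (+-identityʳ _)
𝔼-0 {suc N} b g = trans (cong (b *_) (𝔼-0 b (g ∘ (outside ∷_)))) (sym (*-assoc b (b ^ N) _))

-- Exposing a random set in t rounds, each round halves the mean size of the
-- fragments, while a missed family has no empty fragment.
𝔼-miss≤ : ∀ t b .{{_ : NonZero b}} {r} (𝓐 : List (Subset N)) → 4 * (t + b) ≤ r → Spread r 𝓐 →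
          2 ^ t * length 𝓐 * 𝔼 t b (λ W → ⟦ miss? 𝓐 W ⟧) ≤ (t + b) ^ N * ∑ 𝓐 ∣_∣
𝔼-miss≤ {N} zero b 𝓐 _ _ = begin
  1 * L * 𝔼 0 b (λ W → ⟦ miss? 𝓐 W ⟧)   ≡⟨ cong (1 * L *_) (𝔼-0 {N} b _) ⟩
  1 * L * (b ^ N * ⟦ miss? 𝓐 ⊥ ⟧)       ≡⟨ lem L (b ^ N) _ ⟩
  b ^ N * (⟦ miss? 𝓐 ⊥ ⟧ * L)           ≤⟨ *-monoʳ-≤ (b ^ N) nonempty ⟩
  b ^ N * ∑ 𝓐 ∣_∣                       ∎
  where
  open ≤-Reasoning
  L = length 𝓐
  lem : ∀ l m x → 1 * l * (m * x) ≡ m * (x * l)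
  lem = solve-∀
  0<∣_∣ : ∀ (A : Subset N) → ¬ A ⊆ ⊥ → 1 ≤ ∣ A ∣
  0<∣ A ∣ A⊈⊥ with ∣ A ∣ in eq
  ... | suc _ = s≤s z≤n
  ... | zero  = ⊥-elim (A⊈⊥ (p⊆q∧∣q∣≤∣p∣⇒q⊆p ⊥⊆ (≤-trans (≤-reflexive eq) z≤n)))
  nonempty : ⟦ miss? 𝓐 ⊥ ⟧ * L ≤ ∑ 𝓐 ∣_∣
  nonempty with miss? 𝓐 ⊥
  ... | no  _    = z≤n
  ... | yes miss = begin
    1 * L              ≡⟨ *-comm 1 L ⟩
    L * 1              ≡⟨ ∑-const 𝓐 1 ⟨
    ∑ 𝓐 (λ _ → 1)      ≤⟨ ∑-mono 𝓐 (λ {A} A∈ → 0<∣ A ∣ (All.lookup miss A∈)) ⟩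
    ∑ 𝓐 ∣_∣            ∎
𝔼-miss≤ {N} (suc t) b 𝓐 4m≤r spread =
  -- `M` is the factor that `𝔼-∪` produces when the first round is split off.
  *-cancelˡ-≤ M {{m^n≢0 (t + b) N {{>-nonZero (≤-trans (>-nonZero⁻¹ b) (m≤n+m b t))}}}} (begin
  M * (2 * 2 ^ t * L * 𝔼 (suc t) b (λ W → ⟦ miss? 𝓐 W ⟧))
    ≡⟨ lem M (2 ^ t) L (𝔼 (suc t) b (λ W → ⟦ miss? 𝓐 W ⟧)) ⟩
  2 * (2 ^ t * L) * (M * 𝔼 (suc t) b (λ W → ⟦ miss? 𝓐 W ⟧))
    ≡⟨ cong (2 * (2 ^ t * L) *_) (sym (𝔼-∪ t b (λ W → ⟦ miss? 𝓐 W ⟧))) ⟩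
  2 * (2 ^ t * L) * 𝔼 1 (t + b) (λ W₁ → 𝔼 t b (λ W₂ → ⟦ miss? 𝓐 (W₁ ∪ W₂) ⟧))
    ≡⟨ sym (𝔼-*ˡ 1 (t + b) (2 * (2 ^ t * L)) (λ W₁ → 𝔼 t b (λ W₂ → ⟦ miss? 𝓐 (W₁ ∪ W₂) ⟧))) ⟩
  𝔼 1 (t + b) (λ W₁ → 2 * (2 ^ t * L) * 𝔼 t b (λ W₂ → ⟦ miss? 𝓐 (W₁ ∪ W₂) ⟧))
    ≤⟨ 𝔼-mono 1 (t + b) round ⟩
  𝔼 1 (t + b) (λ W₁ → M * ∑ 𝓐 (λ A → 2 * ∣ fragment 𝓐 W₁ A ∣))
    ≡⟨ 𝔼-*ˡ 1 (t + b) M (λ W₁ → ∑ 𝓐 (λ A → 2 * ∣ fragment 𝓐 W₁ A ∣)) ⟩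
  M * 𝔼 1 (t + b) (λ W₁ → ∑ 𝓐 (λ A → 2 * ∣ fragment 𝓐 W₁ A ∣))
    ≤⟨ *-monoʳ-≤ M (𝔼-fragment≤ 𝓐 4m′≤r spread) ⟩
  M * ((suc t + b) ^ N * ∑ 𝓐 ∣_∣) ∎)
  where
  open ≤-Reasoning
  M = (t + b) ^ N
  L = length 𝓐
  -- The remaining `t` rounds run with total weight `t + b`, smaller by one, so the same `r` still
  -- suffices.
  4m′≤r = ≤-trans (*-monoʳ-≤ 4 (n≤1+n (t + b))) 4m≤r
  lem : ∀ m p l e → m * (2 * p * l * e) ≡ 2 * (p * l) * (m * e)
  lem = solve-∀
  lem′ : ∀ m u → 2 * (m * u) ≡ m * (2 * u)
  lem′ = solve-∀
  round : ∀ W₁ → 2 * (2 ^ t * L) * 𝔼 t b (λ W₂ → ⟦ miss? 𝓐 (W₁ ∪ W₂) ⟧)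
               ≤ M * ∑ 𝓐 (λ A → 2 * ∣ fragment 𝓐 W₁ A ∣)
  round W₁ = begin
    2 * (2 ^ t * L) * 𝔼 t b (λ W₂ → ⟦ miss? 𝓐 (W₁ ∪ W₂) ⟧)
      ≤⟨ *-monoʳ-≤ (2 * (2 ^ t * L)) (𝔼-mono t b (miss-∪≤ 𝓐 W₁)) ⟩
    2 * (2 ^ t * L) * 𝔼 t b (λ W₂ → ⟦ miss? 𝓑 W₂ ⟧)
      ≡⟨ *-assoc 2 (2 ^ t * L) _ ⟩
    2 * (2 ^ t * L * 𝔼 t b (λ W₂ → ⟦ miss? 𝓑 W₂ ⟧))
      ≡⟨ cong (λ l → 2 * (2 ^ t * l * 𝔼 t b (λ W₂ → ⟦ miss? 𝓑 W₂ ⟧))) (sym (length-map (fragment 𝓐 W₁) 𝓐)) ⟩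
    2 * (2 ^ t * length 𝓑 * 𝔼 t b (λ W₂ → ⟦ miss? 𝓑 W₂ ⟧))
      ≤⟨ *-monoʳ-≤ 2 (𝔼-miss≤ t b 𝓑 4m′≤r (fragments-spread 𝓐 W₁ spread)) ⟩
    2 * (M * ∑ 𝓑 ∣_∣)
      ≡⟨ lem′ M (∑ 𝓑 ∣_∣) ⟩
    M * (2 * ∑ 𝓑 ∣_∣)
      ≡⟨ cong (λ u → M * (2 * u)) (∑-map (fragment 𝓐 W₁) 𝓐 ∣_∣) ⟩
    M * (2 * ∑ 𝓐 (λ A → ∣ fragment 𝓐 W₁ A ∣))
      ≡⟨ cong (M *_) (sym (∑-*ˡ 𝓐 2 _)) ⟩
    M * ∑ 𝓐 (λ A → 2 * ∣ fragment 𝓐 W₁ A ∣) ∎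
    where 𝓑 = fragments 𝓐 W₁

-- Random colourings

∑ᶠ-mono : ∀ {m} {f g : Fin m → ℕ} → (∀ i → f i ≤ g i) → ∑ᶠ f ≤ ∑ᶠ g
∑ᶠ-mono {zero}  f≤g = z≤n
∑ᶠ-mono {suc m} f≤g = +-mono-≤ (f≤g zero) (∑ᶠ-mono (f≤g ∘ suc))

∑ᶠ-*ˡ : ∀ {m} c (f : Fin m → ℕ) → ∑ᶠ (λ i → c * f i) ≡ c * ∑ᶠ f
∑ᶠ-*ˡ {zero}  c f = sym (*-zeroʳ c)
∑ᶠ-*ˡ {suc m} c f = trans (cong (c * f zero +_) (∑ᶠ-*ˡ c (f ∘ suc))) (sym (*-distribˡ-+ c (f zero) _))

∑ᶠ-const : ∀ m c → ∑ᶠ {m} (λ _ → c) ≡ m * c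
∑ᶠ-const zero    c = refl
∑ᶠ-const (suc m) c = cong (c +_) (∑ᶠ-const m c)

term≤∑ᶠ : ∀ {m} (f : Fin m → ℕ) i → f i ≤ ∑ᶠ f
term≤∑ᶠ f zero    = m≤m+n _ _
term≤∑ᶠ f (suc i) = ≤-trans (term≤∑ᶠ (f ∘ suc) i) (m≤n+m _ _)

∑ᶠ-pigeonhole : ∀ {m c} (f : Fin m → ℕ) → ∑ᶠ f < m * c → ∃ λ i → f i < c
∑ᶠ-pigeonhole {suc m} {c} f ∑f< with f zero <? c
... | yes f0<c = zero , f0<c
... | no  f0≮c =
  let i , fi<c = ∑ᶠ-pigeonhole {m} {c} (f ∘ suc)
                   (+-cancelˡ-< c _ _ (≤-<-trans (+-monoˡ-≤ _ (≮⇒≥ f0≮c)) ∑f<))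
  in suc i , fi<c

-- Exactly one of the `suc b` colours equals `i`: colouring a point uniformly puts it into class `i`
-- with the weights of `𝔼 1 b`.
∑ᶠ-≟ : ∀ {b} (i : Fin (suc b)) (f : Bool → ℕ) → ∑ᶠ (λ a → f (does (i ≟ a))) ≡ 1 * f true + b * f false
∑ᶠ-≟ {b}     zero    f = cong₂ _+_ (sym (+-identityʳ (f true))) (∑ᶠ-const b (f false))
∑ᶠ-≟ {suc b} (suc i) f = trans (cong (f false +_) (∑ᶠ-≟ i f)) (lem (f false) (f true) b)
  where
  lem : ∀ x y b → x + (1 * y + b * x) ≡ 1 * y + (x + b * x)
  lem = solve-∀

-- The method of conditional expectations.
colouring : ∀ {b} (h : Fin (suc b) → Subset N → ℕ) → ∑ᶠ (λ i → 𝔼 1 b (h i)) < suc b ^ N →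
            ∃ λ (W : Fin (suc b) → Subset N) →
              (∀ i → h i (W i) ≡ 0) × (∀ {i j x} → x ∈ W i → x ∈ W j → i ≡ j)
colouring {zero}  h ∑<1 =
  -- With no points left the total is a natural number below 1, so every term is 0.
  (λ _ → []) , (λ i → n<1⇒n≡0 (≤-<-trans (term≤∑ᶠ (λ i → h i []) i) ∑<1)) , λ ()
colouring {suc N} {b} h ∑< =
  -- The totals conditioned on the colour `a` of the first point add up to the current total, so
  -- some colour keeps the conditional total below `suc b ^ N`.
  let a , Va<            = ∑ᶠ-pigeonhole V (subst (_< suc b * suc b ^ N) (sym ∑V≡) ∑<)
      W , h≡0 , disjoint = colouring (λ i W → h i (does (i ≟ a) ∷ W)) Va<
  in (λ i → does (i ≟ a) ∷ W i) , h≡0 , extend a W disjoint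
  where
  V : Fin (suc b) → ℕ
  V a = ∑ᶠ (λ i → 𝔼 1 b (λ W → h i (does (i ≟ a) ∷ W)))
  ∑V≡ : ∑ᶠ V ≡ ∑ᶠ (λ i → 𝔼 1 b (h i))
  ∑V≡ = trans (∑-comm (λ a i → 𝔼 1 b (λ W → h i (does (i ≟ a) ∷ W))))
              (sum-cong-≗ λ i → ∑ᶠ-≟ i (λ s → 𝔼 1 b (λ W → h i (s ∷ W))))
  head≡ : ∀ a (W : Fin (suc b) → Subset N) i → Fin.zero ∈ (does (i ≟ a) ∷ W i) → i ≡ a
  head≡ a W i x∈ with i ≟ a
  head≡ a W i x∈ | yes i≡a = i≡a
  head≡ a W i () | no _
  extend : ∀ a (W : Fin (suc b) → Subset N) → (∀ {i j x} → x ∈ W i → x ∈ W j → i ≡ j) →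
           ∀ {i j x} → x ∈ (does (i ≟ a) ∷ W i) → x ∈ (does (j ≟ a) ∷ W j) → i ≡ j
  extend a W disjoint {i} {j} {zero}  p q = trans (head≡ a W i p) (sym (head≡ a W j q))
  extend a W disjoint {i} {j} {suc x} p q = disjoint (drop-there p) (drop-there q)

-- Scaling both weights keeps the density and changes only the normalisation; this makes room for
-- several rounds within one colour class.
𝔼-scale : ∀ c a b (g : Subset N → ℕ) → 𝔼 (c * a) (c * b) g ≡ c ^ N * 𝔼 a b g
𝔼-scale {zero}  c a b g = sym (+-identityʳ _)
𝔼-scale {suc N} c a b g = trans
  (cong₂ (λ u v → c * a * u + c * b * v) (𝔼-scale c a b (g ∘ (inside ∷_))) (𝔼-scale c a b (g ∘ (outside ∷_))))
  (lem c a b (c ^ N) _ _)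
  where
  lem : ∀ c a b m p q → c * a * (m * p) + c * b * (m * q) ≡ c * m * (a * p + b * q)
  lem = solve-∀

-- Each W i is a random set of density 1 / s, obtained as the union of β random
-- sets of density 1 / (s * β).
spread-matching : ∀ {s β k} → 1 ≤ s → 1 ≤ β → suc s * k < 2 ^ β →
  (𝓐 : Fin (suc s) → List (Subset N)) → (∀ i → 0 < length (𝓐 i)) →
  (∀ i {A} → A ∈ₗ 𝓐 i → ∣ A ∣ ≤ k) → (∀ i → Spread (4 * (β * suc s)) (𝓐 i)) →
  ∃ λ (A : Fin (suc s) → Subset N) →
    (∀ i → A i ∈ₗ 𝓐 i) × (∀ {i j x} → x ∈ A i → x ∈ A j → i ≡ j)
spread-matching {N} {s} {β} {k} 1≤s 1≤β sk<2^β 𝓐 nonempty ∣A∣≤k spread =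
  let W , missed≡0 , disjoint = colouring missed ∑missed<
      pick i = choose i (missed≡0 i)
  in (λ i → proj₁ (pick i)) , (λ i → proj₁ (proj₂ (pick i))) ,
     λ {i} {j} p q → disjoint (proj₂ (proj₂ (pick i)) p) (proj₂ (proj₂ (pick j)) q)
  where
  open ≤-Reasoning
  instance
    s≢0 : NonZero s
    s≢0 = >-nonZero 1≤s
    β≢0 : NonZero β
    β≢0 = >-nonZero 1≤β
    βs≢0 : NonZero (β * s)
    βs≢0 = m*n≢0 β s
  missed : Fin (suc s) → Subset N → ℕ
  missed i W = ⟦ miss? (𝓐 i) W ⟧
  -- A class of density 1/(1 + s) = β/(β + βs) is exposed in `β` rounds, so it misses a family of
  -- sets of size at most `k` with probability at most k/2^β.
  missed≤ : ∀ i → 2 ^ β * 𝔼 1 s (missed i) ≤ suc s ^ N * k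
  missed≤ i = *-cancelˡ-≤ (L * β ^ N) {{m*n≢0 L (β ^ N) {{>-nonZero (nonempty i)}} {{m^n≢0 β N}}}} (begin
    L * β ^ N * (2 ^ β * 𝔼 1 s (missed i))           ≡⟨ lem L (β ^ N) (2 ^ β) _ ⟩
    2 ^ β * L * (β ^ N * 𝔼 1 s (missed i))           ≡⟨ cong (2 ^ β * L *_) (sym (𝔼-scale β 1 s (missed i))) ⟩
    2 ^ β * L * 𝔼 (β * 1) (β * s) (missed i)         ≡⟨ cong (λ u → 2 ^ β * L * 𝔼 u (β * s) (missed i)) (*-identityʳ β) ⟩
    2 ^ β * L * 𝔼 β (β * s) (missed i)               ≤⟨ 𝔼-miss≤ β (β * s) (𝓐 i)
                                                          (≤-reflexive (cong (4 *_) (sym (*-suc β s)))) (spread i) ⟩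
    (β + β * s) ^ N * ∑ (𝓐 i) ∣_∣                    ≤⟨ *-monoʳ-≤ ((β + β * s) ^ N)
                                                          (≤-trans (∑-mono (𝓐 i) (∣A∣≤k i)) (≤-reflexive (∑-const (𝓐 i) k))) ⟩
    (β + β * s) ^ N * (L * k)                        ≡⟨ cong (λ u → u ^ N * (L * k)) (sym (*-suc β s)) ⟩
    (β * suc s) ^ N * (L * k)                        ≡⟨ cong (_* (L * k)) (^-distribʳ-* N β (suc s)) ⟩
    β ^ N * suc s ^ N * (L * k)                      ≡⟨ lem′ (β ^ N) (suc s ^ N) L k ⟩
    L * β ^ N * (suc s ^ N * k)                      ∎)
    where
    L = length (𝓐 i)
    lem : ∀ l b p e → l * b * (p * e) ≡ p * l * (b * e)
    lem = solve-∀
    lem′ : ∀ b c l k → b * c * (l * k) ≡ l * b * (c * k)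
    lem′ = solve-∀
  -- Union bound over the `suc s` families.
  ∑missed< : ∑ᶠ (λ i → 𝔼 1 s (missed i)) < suc s ^ N
  ∑missed< = *-cancelˡ-< (2 ^ β) _ _ (begin-strict
    2 ^ β * ∑ᶠ (λ i → 𝔼 1 s (missed i))              ≡⟨ ∑ᶠ-*ˡ (2 ^ β) (λ i → 𝔼 1 s (missed i)) ⟨
    ∑ᶠ (λ i → 2 ^ β * 𝔼 1 s (missed i))              ≤⟨ ∑ᶠ-mono missed≤ ⟩
    ∑ᶠ {suc s} (λ _ → suc s ^ N * k)                 ≡⟨ ∑ᶠ-const (suc s) (suc s ^ N * k) ⟩
    suc s * (suc s ^ N * k)                          ≡⟨ lem (suc s) (suc s ^ N) k ⟩
    suc s * k * suc s ^ N                            <⟨ *-monoˡ-< (suc s ^ N) {{m^n≢0 (suc s) N}} sk<2^β ⟩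
    2 ^ β * suc s ^ N                                ∎)
    where
    lem : ∀ s m k → s * (m * k) ≡ s * k * m
    lem = solve-∀
  choose : ∀ i {W} → missed i W ≡ 0 → ∃ λ A → A ∈ₗ 𝓐 i × A ⊆ W
  choose i {W} missed≡0 with any? (_⊆? W) (𝓐 i)
  ... | yes some = find some
  ... | no  none = contradiction (trans (sym missed≡0) (⟦⟧-yes (miss? (𝓐 i) W) (¬Any⇒All¬ (𝓐 i) none))) λ ()

-- Links and cores

length-filter+ : ∀ {p} {P : Pred X p} (P? : Decidable P) xs →
                 length (filter (λ x → ¬? (P? x)) xs) + length (filter P? xs) ≡ length xs
length-filter+ P? []       = refl
length-filter+ P? (x ∷ xs) with P? x
... | yes _ = trans (+-suc _ _) (cong suc (length-filter+ P? xs))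
... | no  _ = cong suc (length-filter+ P? xs)

filter-mono : ∀ {p q} {P : Pred X p} {Q : Pred X q} (P? : Decidable P) (Q? : Decidable Q) xs →
              (∀ {x} → x ∈ₗ xs → P x → Q x) → length (filter P? xs) ≤ length (filter Q? xs)
filter-mono P? Q? xs P⇒Q = subst₂ _≤_
  (sym (length-filter≡∑ P? xs)) (sym (length-filter≡∑ Q? xs))
  (∑-mono xs λ {x} x∈ → ⟦⟧-mono (P? x) (Q? x) (P⇒Q x∈))

cnt-filter : ∀ {p} {P : Pred (Subset N) p} (P? : Decidable P) 𝓐 S → cnt (filter P? 𝓐) S ≤ cnt 𝓐 S
cnt-filter P? []      S = z≤n
cnt-filter P? (A ∷ 𝓐) S with P? A | S ⊆? A in eq
... | no _  | no _  = cnt-filter P? 𝓐 S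
... | no _  | yes _ = m≤n⇒m≤1+n (cnt-filter P? 𝓐 S)
... | yes _ | no _  rewrite eq = cnt-filter P? 𝓐 S
... | yes _ | yes _ rewrite eq = s≤s (cnt-filter P? 𝓐 S)

0<length⇒∈ : (xs : List X) → 0 < length xs → ∃ λ x → x ∈ₗ xs
0<length⇒∈ (x ∷ _) _ = x , here refl

x∈p⇒⁅x⁆⊆p : ∀ {x} {p : Subset N} → x ∈ p → ⁅ x ⁆ ⊆ p
x∈p⇒⁅x⁆⊆p {x = x} x∈p y∈ rewrite x∈⁅y⁆⇒x≡y x y∈ = x∈p

infixl 6 _∖_

_∖_ : List (Subset N) → List (Fin N) → List (Subset N)
𝓐 ∖ []      = 𝓐
𝓐 ∖ (v ∷ D) = filter (λ A → ¬? (v ∈? A)) (𝓐 ∖ D)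

∈-∖⁻ : ∀ {𝓐 : List (Subset N)} {A} D → A ∈ₗ 𝓐 ∖ D → A ∈ₗ 𝓐 × (∀ {v} → v ∈ₗ D → v ∉ A)
∈-∖⁻ []      A∈ = A∈ , λ ()
∈-∖⁻ (v ∷ D) A∈ =
  let A∈′ , v∉A = ∈-filter⁻ (λ A → ¬? (v ∈? A)) A∈
      A∈𝓐 , D∉A = ∈-∖⁻ D A∈′
  in A∈𝓐 , λ { (here refl) → v∉A ; (there u∈D) → D∉A u∈D }

cnt-∖ : ∀ (𝓐 : List (Subset N)) D S → cnt (𝓐 ∖ D) S ≤ cnt 𝓐 S
cnt-∖ 𝓐 []      S = ≤-refl
cnt-∖ 𝓐 (v ∷ D) S = ≤-trans (cnt-filter _ (𝓐 ∖ D) S) (cnt-∖ 𝓐 D S)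

-- Each deleted vertex costs at most its degree in the original family, at most c/a. The factor `a`
-- keeps fractional degree bounds such as P/n² within ℕ.
length-∖ : ∀ {a c} (𝓐 : List (Subset N)) D → (∀ v → a * cnt 𝓐 ⁅ v ⁆ ≤ c) →
           a * length 𝓐 ≤ a * length (𝓐 ∖ D) + length D * c
length-∖         𝓐 []      bound = ≤-reflexive (sym (+-identityʳ _))
length-∖ {a = a} {c} 𝓐 (v ∷ D) bound = begin
  a * length 𝓐                                           ≤⟨ length-∖ {a = a} 𝓐 D bound ⟩
  a * length (𝓐 ∖ D) + length D * c                      ≡⟨ cong (λ l → a * l + length D * c) (sym (length-filter+ (v ∈?_) (𝓐 ∖ D))) ⟩
  a * (l + length (filter (v ∈?_) (𝓐 ∖ D))) + length D * c
    ≤⟨ +-monoˡ-≤ _ (*-monoʳ-≤ a (+-monoʳ-≤ l (≤-trans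
         (filter-mono (v ∈?_) (⁅ v ⁆ ⊆?_) (𝓐 ∖ D) λ _ v∈ {x} → x∈p⇒⁅x⁆⊆p v∈) (cnt-∖ 𝓐 D ⁅ v ⁆)))) ⟩
  a * (l + cnt 𝓐 ⁅ v ⁆) + length D * c                   ≡⟨ lem a l (cnt 𝓐 ⁅ v ⁆) _ ⟩
  a * l + (a * cnt 𝓐 ⁅ v ⁆ + length D * c)               ≤⟨ +-monoʳ-≤ (a * l) (+-monoˡ-≤ _ (bound v)) ⟩
  a * l + (c + length D * c)                             ∎
  where
  open ≤-Reasoning
  l = length (𝓐 ∖ (v ∷ D))
  lem : ∀ a l x y → a * (l + x) + y ≡ a * l + (a * x + y)
  lem = solve-∀

∣p∪q∣+∣p∩q∣ : ∀ (p q : Subset N) → ∣ p ∪ q ∣ + ∣ p ∩ q ∣ ≡ ∣ p ∣ + ∣ q ∣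
∣p∪q∣+∣p∩q∣ []            []            = refl
∣p∪q∣+∣p∩q∣ (inside ∷ p)  (inside ∷ q)  = cong suc (trans (+-suc _ _) (trans (cong suc (∣p∪q∣+∣p∩q∣ p q)) (sym (+-suc _ _))))
∣p∪q∣+∣p∩q∣ (inside ∷ p)  (outside ∷ q) = cong suc (∣p∪q∣+∣p∩q∣ p q)
∣p∪q∣+∣p∩q∣ (outside ∷ p) (inside ∷ q)  = trans (cong suc (∣p∪q∣+∣p∩q∣ p q)) (sym (+-suc _ _))
∣p∪q∣+∣p∩q∣ (outside ∷ p) (outside ∷ q) = ∣p∪q∣+∣p∩q∣ p q

∣p∪q∣≡∣p∣+∣q∣ : ∀ (p q : Subset N) → Empty (p ∩ q) → ∣ p ∪ q ∣ ≡ ∣ p ∣ + ∣ q ∣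
∣p∪q∣≡∣p∣+∣q∣ {N} p q disjoint = trans (sym (+-identityʳ _))
  (trans (cong (∣ p ∪ q ∣ +_) (sym (trans (cong ∣_∣ (Empty-unique disjoint)) (∣⊥∣≡0 N)))) (∣p∪q∣+∣p∩q∣ p q))

p─q∪q≡p : ∀ {p q : Subset N} → q ⊆ p → (p ─ q) ∪ q ≡ p
p─q∪q≡p {p = p} {q} q⊆p = ⊆-antisym (∪-least (p─q⊆p p q) q⊆p)
  λ x∈p → [ x∈p∪q⁺ ∘ inj₂ , x∈p∪q⁺ ∘ inj₁ ]′ (x∈p∪q⁻ q (p ─ q) (p⊆q∪p─q p q x∈p))

link : List (Subset N) → Subset N → List (Subset N)
link 𝓐 S = map (_─ S) (filter (S ⊆?_) 𝓐)

length-link : ∀ (𝓐 : List (Subset N)) S → length (link 𝓐 S) ≡ cnt 𝓐 S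
length-link 𝓐 S = length-map (_─ S) (filter (S ⊆?_) 𝓐)

∈-link⁻ : ∀ {A} (𝓐 : List (Subset N)) S → A ∈ₗ link 𝓐 S →
          A ∪ S ∈ₗ 𝓐 × (∀ {x} → x ∈ S → x ∉ A)
∈-link⁻ 𝓐 S A∈ with A′ , A′∈ , refl , S⊆A′ ← ∈-map∘filter⁻ (_─ S) (S ⊆?_) A∈ =
  subst (_∈ₗ 𝓐) (sym (p─q∪q≡p S⊆A′)) A′∈ , λ x∈S x∈A → x∈p─q⇒x∉q A′ S x∈A x∈S

-- Members of the link avoid `S`, so none contains a `T` meeting `S`. For disjoint `T`, a link
-- member containing `T` comes from a member containing `T ∪ S`.
cnt-link : ∀ (𝓐 : List (Subset N)) S T →
           cnt (link 𝓐 S) T ≡ 0 ⊎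
           (∣ T ∪ S ∣ ≡ ∣ T ∣ + ∣ S ∣ × cnt (link 𝓐 S) T ≤ cnt 𝓐 (T ∪ S))
cnt-link 𝓐 S T with nonempty? (T ∩ S)
... | yes (x , x∈) = inj₁ (cong length (filter-none (T ⊆?_) (All.tabulate λ A∈ T⊆A →
        let x∈T , x∈S = x∈p∩q⁻ T S x∈ in proj₂ (∈-link⁻ 𝓐 S A∈) x∈S (T⊆A x∈T))))
... | no disjoint  = inj₂ (∣p∪q∣≡∣p∣+∣q∣ T S disjoint , (begin
  cnt (map (_─ S) (filter (S ⊆?_) 𝓐)) T     ≡⟨ length-filter≡∑ (T ⊆?_) (link 𝓐 S) ⟩
  ∑ (map (_─ S) (filter (S ⊆?_) 𝓐)) _       ≡⟨ ∑-map (_─ S) (filter (S ⊆?_) 𝓐) _ ⟩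
  ∑ (filter (S ⊆?_) 𝓐) (λ A → ⟦ T ⊆? A ─ S ⟧)
    ≤⟨ ∑-mono (filter (S ⊆?_) 𝓐) (λ {A} A∈ → ⟦⟧-mono (T ⊆? A ─ S) (T ∪ S ⊆? A) λ T⊆A─S {x} →
         ∪-least {r = A} (λ x∈T → p─q⊆p A S (T⊆A─S x∈T)) (proj₂ (∈-filter⁻ (S ⊆?_) {xs = 𝓐} A∈)) {x}) ⟩
  ∑ (filter (S ⊆?_) 𝓐) (λ A → ⟦ T ∪ S ⊆? A ⟧)  ≡⟨ length-filter≡∑ (T ∪ S ⊆?_) (filter (S ⊆?_) 𝓐) ⟨
  cnt (filter (S ⊆?_) 𝓐) (T ∪ S)            ≤⟨ cnt-filter (S ⊆?_) 𝓐 (T ∪ S) ⟩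
  cnt 𝓐 (T ∪ S)                             ∎))
  where open ≤-Reasoning

-- Recursion on `d`, a bound on how much the size of `S` can still grow; every improvement uses up
-- at least one unit.
maximal : ∀ {P : Subset N → Set} → Decidable P → ∀ d S → N ≤ ∣ S ∣ + d → P S →
          ∃ λ S → P S × (∀ T → P T → ∣ T ∣ ≤ ∣ S ∣)
maximal P? zero    S N≤ pS = S , pS , λ T _ → ≤-trans (∣p∣≤n T) (≤-trans N≤ (≤-reflexive (+-identityʳ _)))
maximal P? (suc d) S N≤ pS with anySubset? (λ T → P? T ×-dec (∣ S ∣ <? ∣ T ∣))
... | yes (T , pT , S<T) = maximal P? d T (≤-trans N≤ (≤-trans (≤-reflexive (+-suc _ d)) (+-monoˡ-≤ d S<T))) pT
... | no  none           = S , pS , λ T pT → ≮⇒≥ (λ S<T → none (T , pT , S<T))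

-- S is a set of maximal size subject to |𝓐| ≤ r ^ |S| |𝓐(S)|.
spread-link : ∀ r .{{_ : NonZero r}} (𝓐 : List (Subset N)) →
              ∃ λ S → length 𝓐 ≤ r ^ ∣ S ∣ * cnt 𝓐 S × Spread r (link 𝓐 S)
spread-link {N} r 𝓐 with maximal (λ S → length 𝓐 ≤? r ^ ∣ S ∣ * cnt 𝓐 S) N ⊥ (m≤n+m N _) start
  where
  start : length 𝓐 ≤ r ^ ∣ ⊥ {N} ∣ * cnt 𝓐 ⊥
  start = ≤-reflexive (sym (trans
    (cong₂ (λ t l → r ^ t * l) (∣⊥∣≡0 N) (cong length (filter-all (⊥ ⊆?_) {𝓐} (All.tabulate λ _ {x} → ⊥⊆ {x = x}))))
    (+-identityʳ _)))
... | S , large , max = S , large , spread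
  where
  open ≤-Reasoning
  spread : Spread r (link 𝓐 S)
  spread T with ∣ T ∣ in eq | cnt-link 𝓐 S T
  ... | zero  | _ = ≤-trans (≤-reflexive (+-identityʳ _)) (length-filter (T ⊆?_) (link 𝓐 S))
  ... | suc t | inj₁ cnt≡0 = ≤-trans (≤-reflexive (trans (cong (r ^ suc t *_) cnt≡0) (*-zeroʳ (r ^ suc t)))) z≤n
  -- Here `T ∪ S` is strictly larger than `S`, so by maximality it fails the defining inequality of
  -- `S`.
  ... | suc t | inj₂ (∣T∪S∣≡ , cnt≤) = *-cancelˡ-≤ (r ^ ∣ S ∣) {{m^n≢0 r ∣ S ∣}} (begin
    r ^ ∣ S ∣ * (r ^ suc t * cnt (link 𝓐 S) T)   ≤⟨ *-monoʳ-≤ (r ^ ∣ S ∣) (*-monoʳ-≤ (r ^ suc t) cnt≤) ⟩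
    r ^ ∣ S ∣ * (r ^ suc t * cnt 𝓐 (T ∪ S))      ≡⟨ lem (r ^ ∣ S ∣) (r ^ suc t) _ ⟩
    r ^ suc t * r ^ ∣ S ∣ * cnt 𝓐 (T ∪ S)        ≡⟨ cong (_* cnt 𝓐 (T ∪ S)) (sym (^-distribˡ-+-* r (suc t) ∣ S ∣)) ⟩
    r ^ (suc t + ∣ S ∣) * cnt 𝓐 (T ∪ S)          ≡⟨ cong (λ u → r ^ u * cnt 𝓐 (T ∪ S)) (sym ∣T∪S∣≡) ⟩
    r ^ ∣ T ∪ S ∣ * cnt 𝓐 (T ∪ S)                ≤⟨ <⇒≤ (≰⇒> (λ large′ → <⇒≱ S<T∪S (max (T ∪ S) large′))) ⟩
    length 𝓐                                     ≤⟨ large ⟩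
    r ^ ∣ S ∣ * cnt 𝓐 S                          ≡⟨ cong (r ^ ∣ S ∣ *_) (sym (length-link 𝓐 S)) ⟩
    r ^ ∣ S ∣ * length (link 𝓐 S)                ∎)
    where
    lem : ∀ a b c → a * (b * c) ≡ b * a * c
    lem = solve-∀
    S<T∪S : ∣ S ∣ < ∣ T ∪ S ∣
    S<T∪S = ≤-trans (s≤s (m≤n+m ∣ S ∣ t)) (≤-reflexive (sym ∣T∪S∣≡))

support : ∀ (S : Subset N) → ∃ λ xs → length xs ≡ ∣ S ∣ × (∀ {x} → x ∈ S → x ∈ₗ xs)
support []            = [] , refl , λ ()
support (inside ∷ S)  with xs , len , sub ← support S =
  zero ∷ map suc xs , cong suc (trans (length-map suc xs) len) ,
  λ { Vec.here → here refl ; (Vec.there x∈) → there (∈-map⁺ suc (sub x∈)) }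
support (outside ∷ S) with xs , len , sub ← support S =
  map suc xs , trans (length-map suc xs) len , λ { (Vec.there x∈) → ∈-map⁺ suc (sub x∈) }

-- `D` lists the forbidden vertices. `supp` enumerates `S` as a list, the form in which vertices to
-- be avoided later are accumulated.
record Core (R : ℕ) (𝓔 : List (Subset N)) (D : List (Fin N)) : Set where
  field
    S         : Subset N
    supp      : List (Fin N)
    supp≤2    : length supp ≤ 2
    S⊆supp    : ∀ {x} → x ∈ S → x ∈ₗ supp
    S∩D       : ∀ {x} → x ∈ S → x ∉ₗ D
    petals    : List (Subset N)
    nonempty  : 0 < length petals
    spread    : Spread R petals
    petal∪S   : ∀ {A} → A ∈ₗ petals → A ∪ S ∈ₗ 𝓔

-- `u` is the number of vertices that other choices may already have taken.
Robust : ℕ → ℕ → List (Subset N) → Set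
Robust R u 𝓔 = ∀ D → length D ≤ u → Core R 𝓔 D

module _ {n R : ℕ} (1≤R : 1 ≤ R) (4R³≤n² : 4 * R ^ 3 ≤ n ^ 2) where

  R≤n : R ≤ n
  R≤n = ≮⇒≥ λ n<R → <⇒≱ (^-monoˡ-< 2 n<R) (begin
    R ^ 2            ≤⟨ ^-monoʳ-≤ R {{>-nonZero 1≤R}} (n≤1+n 2) ⟩
    R ^ 3            ≤⟨ m≤m+n (R ^ 3) _ ⟩
    4 * R ^ 3        ≤⟨ 4R³≤n² ⟩
    n ^ 2            ∎)
    where open ≤-Reasoning

  private instance
    n≢0 : NonZero n
    n≢0 = >-nonZero (≤-trans 1≤R R≤n)
    R≢0 : NonZero R
    R≢0 = >-nonZero 1≤R

  -- With L = `length (𝓔 ∖ D)`, maximality in `spread-link` yields a set with c n^|S| L ≤ R^|S| Q <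
  -- R^|S| · 4ncL. For |S| = 3 + t this gives n^(2 + t) < 4 R^(3 + t), contrary to 4R³ ≤ n² and R ≤
  -- n. The factor `c` allows for links: it is 1 for a family and `n` for the link of a vertex.
  core : ∀ {c Q} (𝓔 : List (Subset N)) D →
         (∀ S → c * n ^ ∣ S ∣ * cnt 𝓔 S ≤ Q) → Q < 4 * (n * (c * length (𝓔 ∖ D))) → Core R 𝓔 D
  core {c = c} {Q} 𝓔 D bound Q< with S , large , spread ← spread-link R (𝓔 ∖ D)
                             with supp , len , sub ← support S = record
    { S = S ; supp = supp ; supp≤2 = ≤-trans (≤-reflexive len) ∣S∣≤2 ; S⊆supp = sub
    -- Some petal exists, and its union with `S` is a member of `𝓔 ∖ D`; hence `S` avoids `D`.
    ; S∩D = λ x∈S x∈D → proj₂ (∈-∖⁻ D (proj₁ (∈-link⁻ (𝓔 ∖ D) S (proj₂ somePetal)))) x∈D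
              (q⊆p∪q (proj₁ somePetal) S x∈S)
    ; petals = link (𝓔 ∖ D) S ; nonempty = nonempty ; spread = spread
    ; petal∪S = λ A∈ → proj₁ (∈-∖⁻ D (proj₁ (∈-link⁻ (𝓔 ∖ D) S A∈))) }
    where
    open ≤-Reasoning
    L = length (𝓔 ∖ D)
    0<L : 0 < L
    0<L with L
    ... | suc _ = s≤s z≤n
    ... | zero  = contradiction (≤-trans Q< (≤-reflexive (lem n c))) λ ()
      where
      lem : ∀ n c → 4 * (n * (c * 0)) ≡ 0
      lem = solve-∀
    nonempty : 0 < length (link (𝓔 ∖ D) S)
    nonempty = ≤-trans (0<cnt (cnt (𝓔 ∖ D) S) large) (≤-reflexive (sym (length-link (𝓔 ∖ D) S)))
      where
      0<cnt : ∀ l → L ≤ R ^ ∣ S ∣ * l → 0 < l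
      0<cnt (suc _) _  = s≤s z≤n
      0<cnt zero    L≤ = contradiction (≤-trans 0<L (≤-trans L≤ (≤-reflexive (*-zeroʳ (R ^ ∣ S ∣))))) λ ()
    somePetal = 0<length⇒∈ (link (𝓔 ∖ D) S) nonempty
    lem₁ : ∀ c n m l → 4 * (c * (n * m) * l) ≡ m * (4 * (n * (c * l)))
    lem₁ = solve-∀
    ∣S∣≤2 : ∣ S ∣ ≤ 2
    ∣S∣≤2 with ∣ S ∣ ≤? 2
    ... | yes ≤2 = ≤2
    ... | no  ≰2 with t , ∣S∣≡ ← m≤n⇒∃[o]m+o≡n (≰⇒> ≰2) = contradiction (begin-strict
      n ^ 2 * Q                       <⟨ *-monoʳ-< (n ^ 2) {{m^n≢0 n 2}} Q< ⟩
      n ^ 2 * (4 * (n * (c * L)))     ≡⟨ lem₁ c n (n ^ 2) L ⟨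
      4 * (c * n ^ 3 * L)             ≤⟨ *-monoʳ-≤ 4 cn³L≤R³Q ⟩
      4 * (R ^ 3 * Q)                 ≡⟨ *-assoc 4 (R ^ 3) Q ⟨
      4 * R ^ 3 * Q                   ≤⟨ *-monoˡ-≤ Q 4R³≤n² ⟩
      n ^ 2 * Q                       ∎) (n≮n _)
      where
      lem₃ : ∀ a b c l → c * (a * b) * l ≡ b * (c * a * l)
      lem₃ = solve-∀
      lem₄ : ∀ c m r k → c * m * (r * k) ≡ r * (c * m * k)
      lem₄ = solve-∀
      cn³L≤R³Q : c * n ^ 3 * L ≤ R ^ 3 * Q
      cn³L≤R³Q = *-cancelˡ-≤ (n ^ t) {{m^n≢0 n t}} (begin
        n ^ t * (c * n ^ 3 * L)                 ≡⟨ lem₃ (n ^ 3) (n ^ t) c L ⟨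
        c * (n ^ 3 * n ^ t) * L                 ≡⟨ cong (λ u → c * u * L) (sym (^-distribˡ-+-* n 3 t)) ⟩
        c * n ^ (3 + t) * L                     ≡⟨ cong (λ u → c * n ^ u * L) ∣S∣≡ ⟩
        c * n ^ ∣ S ∣ * L                       ≤⟨ *-monoʳ-≤ (c * n ^ ∣ S ∣) large ⟩
        c * n ^ ∣ S ∣ * (R ^ ∣ S ∣ * cnt (𝓔 ∖ D) S) ≡⟨ lem₄ c (n ^ ∣ S ∣) (R ^ ∣ S ∣) _ ⟩
        R ^ ∣ S ∣ * (c * n ^ ∣ S ∣ * cnt (𝓔 ∖ D) S) ≤⟨ *-monoʳ-≤ (R ^ ∣ S ∣) (≤-trans
                                                     (*-monoʳ-≤ (c * n ^ ∣ S ∣) (cnt-∖ 𝓔 D S)) (bound S)) ⟩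
        R ^ ∣ S ∣ * Q                           ≡⟨ cong (λ u → R ^ u * Q) (sym ∣S∣≡) ⟩
        R ^ (3 + t) * Q                         ≡⟨ cong (_* Q) (^-distribˡ-+-* R 3 t) ⟩
        R ^ 3 * R ^ t * Q                       ≤⟨ *-monoˡ-≤ Q (*-monoʳ-≤ (R ^ 3) (^-monoˡ-≤ t R≤n)) ⟩
        R ^ 3 * n ^ t * Q                       ≡⟨ lem₅ (R ^ 3) (n ^ t) Q ⟩
        n ^ t * (R ^ 3 * Q)                     ∎)
        where
        lem₅ : ∀ a b c → a * b * c ≡ b * (a * c)
        lem₅ = solve-∀

-- Greedy choice of cores

open Core

weaken : ∀ {R} {𝓔 : List (Subset N)} D′ {D} → Core R 𝓔 (D′ ++ D) → Core R 𝓔 D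
weaken D′ c = record
  { S = S c ; supp = supp c ; supp≤2 = supp≤2 c ; S⊆supp = S⊆supp c
  ; S∩D = λ x∈S x∈D → S∩D c x∈S (∈-++⁺ʳ D′ x∈D)
  ; petals = petals c ; nonempty = nonempty c ; spread = spread c ; petal∪S = petal∪S c }

record Greedy (R : ℕ) (𝓔 : X → List (Subset N)) (xs : List X) (D : List (Fin N)) : Set where
  field
    cores    : ∀ {i} → i ∈ₗ xs → Core R (𝓔 i) D
    used     : List (Fin N)
    used≤    : length used ≤ length xs * 2
    S⊆used   : ∀ {i x} (i∈ : i ∈ₗ xs) → x ∈ S (cores i∈) → x ∈ₗ used
    disjoint : ∀ {i j x} (i∈ : i ∈ₗ xs) (j∈ : j ∈ₗ xs) → x ∈ S (cores i∈) → x ∈ S (cores j∈) → i ≡ j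

-- Each core adds at most two vertices to those forbidden for the later ones. The `+ 2` in the
-- budget is there because the last core does not have to avoid itself.
greedy : ∀ {R u} (𝓔 : X → List (Subset N)) xs D → (∀ {i} → i ∈ₗ xs → Robust R u (𝓔 i)) →
         length D + length xs * 2 ≤ u + 2 → Greedy R 𝓔 xs D
greedy 𝓔 []       D robust _      = record
  { cores = λ () ; used = [] ; used≤ = z≤n ; S⊆used = λ () ; disjoint = λ () }
greedy {u = u} 𝓔 (i ∷ xs) D robust budget = record
  { cores    = cores′
  ; used     = supp c ++ Greedy.used rest
  ; used≤    = ≤-trans (≤-reflexive (length-++ (supp c))) (+-mono-≤ (supp≤2 c) (Greedy.used≤ rest))
  ; S⊆used   = λ { (here refl) x∈ → ∈-++⁺ˡ (S⊆supp c x∈)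
                 ; (there i∈)  x∈ → ∈-++⁺ʳ (supp c) (Greedy.S⊆used rest i∈ x∈) }
  ; disjoint = disjoint′ }
  where
  open ≤-Reasoning
  c = robust (here refl) D (+-cancelʳ-≤ 2 _ _ (≤-trans (+-monoʳ-≤ (length D) (m≤m+n 2 _)) budget))
  rest = greedy {u = u} 𝓔 xs (supp c ++ D) (robust ∘ there) (begin
    length (supp c ++ D) + length xs * 2            ≡⟨ cong (_+ length xs * 2) (length-++ (supp c)) ⟩
    length (supp c) + length D + length xs * 2      ≤⟨ +-monoˡ-≤ (length xs * 2) (+-monoˡ-≤ (length D) (supp≤2 c)) ⟩
    2 + length D + length xs * 2                    ≡⟨ cong (_+ length xs * 2) (+-comm 2 (length D)) ⟩
    length D + 2 + length xs * 2                    ≡⟨ +-assoc (length D) 2 _ ⟩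
    length D + (2 + length xs * 2)                  ≤⟨ budget ⟩
    u + 2                                           ∎)
  cores′ : ∀ {j} → j ∈ₗ i ∷ xs → Core _ (𝓔 j) D
  cores′ (here refl) = c
  cores′ (there j∈)  = weaken (supp c) (Greedy.cores rest j∈)
  disjoint′ : ∀ {j j′ x} (j∈ : j ∈ₗ i ∷ xs) (j′∈ : j′ ∈ₗ i ∷ xs) →
              x ∈ S (cores′ j∈) → x ∈ S (cores′ j′∈) → j ≡ j′
  disjoint′ (here refl) (here refl) _ _ = refl
  disjoint′ (here refl) (there j′∈) p q =
    contradiction (∈-++⁺ˡ (S⊆supp c p)) (S∩D (Greedy.cores rest j′∈) q)
  disjoint′ (there j∈)  (here refl) p q =
    contradiction (∈-++⁺ˡ (S⊆supp c q)) (S∩D (Greedy.cores rest j∈) p)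
  disjoint′ (there j∈)  (there j′∈) p q = Greedy.disjoint rest j∈ j′∈ p q

-- Stems of light and heavy families

-- The stem B i is empty if i is light and a single vertex if i is heavy.
record Stems (R s : ℕ) {m} (𝓕 : Fin m → List (Subset N)) (D : List (Fin N)) : Set where
  field
    B            : Fin m → Subset N
    𝓔            : Fin m → List (Subset N)
    light heavy  : List (Fin m)
    stems        : List (Fin N)
    E∪B∈F        : ∀ i {A} → A ∈ₗ 𝓔 i → A ∪ B i ∈ₗ 𝓕 i
    B-disjoint   : ∀ {i j x} → x ∈ B i → x ∈ B j → i ≡ j
    B∩D          : ∀ {i x} → x ∈ B i → x ∉ₗ D
    B⊆stems      : ∀ {i x} → x ∈ B i → x ∈ₗ stems
    stems≤       : length stems ≤ length heavy
    light-robust : ∀ {i} → i ∈ₗ light → Robust R (2 * s) (𝓔 i)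
    heavy-robust : ∀ {i} → i ∈ₗ heavy → Robust R (3 * s ∸ 2) (𝓔 i)
    cover        : ∀ i → i ∈ₗ light ⊎ i ∈ₗ heavy
    count        : length light + length heavy ≡ m

module _ {n R s P : ℕ} (1≤R : 1 ≤ R) (4R³≤n² : 4 * R ^ 3 ≤ n ^ 2)
         (1≤s : 1 ≤ s) (8s²≤n : 8 * s ^ 2 ≤ n) (0<P : 0 < P) where

  private instance
    n≢0 : NonZero n
    n≢0 = >-nonZero (≤-trans 1≤R (R≤n 1≤R 4R³≤n²))

  -- Deleting 2s vertices of degree at most 3sP/n² costs at most 6s²P/n² ≤ 3P/(4n) members, since
  -- 8s² ≤ n. Of more than P/n members, more than P/(4n) remain, as `core` demands with `c = 1`.
  light-is-robust : (𝓔 : List (Subset N)) → (∀ S → n ^ ∣ S ∣ * cnt 𝓔 S ≤ P) →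
                    P < n * length 𝓔 → (∀ v → n ^ 2 * cnt 𝓔 ⁅ v ⁆ ≤ 3 * s * P) → Robust R (2 * s) 𝓔
  light-is-robust 𝓔 bound P< degrees D D≤ = core 1≤R 4R³≤n² {c = 1} {P} 𝓔 D
    (λ S → ≤-trans (≤-reflexive (cong (_* cnt 𝓔 S) (+-identityʳ (n ^ ∣ S ∣)))) (bound S))
    (*-cancelˡ-< n _ _ (+-cancelʳ-< (3 * (n * P)) _ _ (begin-strict
      n * P + 3 * (n * P)                             ≡⟨⟩
      4 * (n * P)                                     <⟨ *-monoʳ-< 4 (*-monoʳ-< n P<) ⟩
      4 * (n * (n * length 𝓔))                        ≡⟨ cong (4 *_) (lem₁ n (length 𝓔)) ⟩
      4 * (n ^ 2 * length 𝓔)                          ≤⟨ *-monoʳ-≤ 4 (length-∖ {a = n ^ 2} 𝓔 D degrees) ⟩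
      4 * (n ^ 2 * l + length D * (3 * s * P))        ≤⟨ *-monoʳ-≤ 4 (+-monoʳ-≤ (n ^ 2 * l) (*-monoˡ-≤ (3 * s * P) D≤)) ⟩
      4 * (n ^ 2 * l + 2 * s * (3 * s * P))           ≡⟨ lem₂ n l s P ⟩
      n * (4 * (n * (1 * l))) + 3 * (8 * (s * (s * 1)) * P) ≤⟨ +-monoʳ-≤ (n * (4 * (n * (1 * l)))) (*-monoʳ-≤ 3 (*-monoˡ-≤ P 8s²≤n)) ⟩
      n * (4 * (n * (1 * l))) + 3 * (n * P)           ∎)))
    where
    open ≤-Reasoning
    l = length (𝓔 ∖ D)
    lem₁ : ∀ n x → n * (n * x) ≡ n * (n * 1) * x
    lem₁ = solve-∀
    lem₂ : ∀ n l s P → 4 * (n * (n * 1) * l + 2 * s * (3 * s * P)) ≡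
                       n * (4 * (n * (1 * l))) + 3 * (8 * (s * (s * 1)) * P)
    lem₂ = solve-∀

  -- The link of `v` has at least 3sP/n² members, and every vertex has degree at most P/n² in it.
  -- After deleting 3s - 2 vertices at least 2P/n² members remain, more than `core` demands with
  -- `c = n`.
  heavy-is-robust : (𝓔 : List (Subset N)) → (∀ S → n ^ ∣ S ∣ * cnt 𝓔 S ≤ P) →
                    ∀ v → 3 * s * P ≤ n ^ 2 * cnt 𝓔 ⁅ v ⁆ → Robust R (3 * s ∸ 2) (link 𝓔 ⁅ v ⁆)
  heavy-is-robust 𝓔 bound v heavy D D≤ = core 1≤R 4R³≤n² {c = n} {P} 𝓛 D bound′ (begin-strict
      P                                               <⟨ m<m+n P 0<P ⟩
      P + P                                           ≤⟨ +-cancelʳ-≤ (length D * P) _ _ 2P≤ ⟩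
      n ^ 2 * l                                       ≤⟨ m≤m+n (n ^ 2 * l) _ ⟩
      4 * (n ^ 2 * l)                                 ≡⟨ cong (4 *_) (lem₁ n l) ⟨
      4 * (n * (n * l))                               ∎)
    where
    open ≤-Reasoning
    𝓛 = link 𝓔 ⁅ v ⁆
    l = length (𝓛 ∖ D)
    lem₁ : ∀ n x → n * (n * x) ≡ n * (n * 1) * x
    lem₁ = solve-∀
    bound′ : ∀ T → n * n ^ ∣ T ∣ * cnt 𝓛 T ≤ P
    bound′ T with cnt-link 𝓔 ⁅ v ⁆ T
    ... | inj₁ cnt≡0 = ≤-trans (≤-reflexive (trans (cong (n * n ^ ∣ T ∣ *_) cnt≡0) (*-zeroʳ (n * n ^ ∣ T ∣)))) z≤n
    ... | inj₂ (∣T∪v∣≡ , cnt≤) = begin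
      n ^ suc ∣ T ∣ * cnt 𝓛 T                   ≤⟨ *-monoʳ-≤ (n ^ suc ∣ T ∣) cnt≤ ⟩
      n ^ suc ∣ T ∣ * cnt 𝓔 (T ∪ ⁅ v ⁆)         ≡⟨ cong (λ u → n ^ u * cnt 𝓔 (T ∪ ⁅ v ⁆))
                                                     (sym (trans ∣T∪v∣≡ (trans (cong (∣ T ∣ +_) (∣⁅x⁆∣≡1 v)) (+-comm ∣ T ∣ 1)))) ⟩
      n ^ ∣ T ∪ ⁅ v ⁆ ∣ * cnt 𝓔 (T ∪ ⁅ v ⁆)     ≤⟨ bound (T ∪ ⁅ v ⁆) ⟩
      P                                         ∎
    degrees : ∀ w → n ^ 2 * cnt 𝓛 ⁅ w ⁆ ≤ P
    degrees w = subst (λ t → n * n ^ t * cnt 𝓛 ⁅ w ⁆ ≤ P) (∣⁅x⁆∣≡1 w) (bound′ ⁅ w ⁆)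
    2+D≤ : 2 + length D ≤ 3 * s
    2+D≤ = ≤-trans (+-monoʳ-≤ 2 D≤) (≤-reflexive (m+[n∸m]≡n (≤-trans (n≤1+n 2) (*-monoʳ-≤ 3 1≤s))))
    2P≤ : P + P + length D * P ≤ n ^ 2 * l + length D * P
    2P≤ = begin
      P + P + length D * P                     ≡⟨ +-assoc P P _ ⟩
      (2 + length D) * P                       ≤⟨ *-monoˡ-≤ P 2+D≤ ⟩
      3 * s * P                                ≤⟨ heavy ⟩
      n ^ 2 * cnt 𝓔 ⁅ v ⁆                      ≡⟨ cong (n ^ 2 *_) (length-link 𝓔 ⁅ v ⁆) ⟨
      n ^ 2 * length 𝓛                         ≤⟨ length-∖ {a = n ^ 2} 𝓛 D degrees ⟩
      n ^ 2 * l + length D * P                 ∎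

  private
    tail-robust : ∀ {m u is} (𝓔 : Fin (suc m) → List (Subset N)) →
                  (∀ {i} → i ∈ₗ is → Robust R u (𝓔 (suc i))) → ∀ {i} → i ∈ₗ map suc is → Robust R u (𝓔 i)
    tail-robust 𝓔 robust i∈ with _ , j∈ , refl ← ∈-map⁻ suc i∈ = robust j∈

    -- A vertex lies in at most P/n members, so `d` deletions leave more than P/n out of more than
    -- (d + 1)P/n.
    survivors : ∀ {d} (𝓕 : List (Subset N)) D → length D ≤ d → (∀ S → n ^ ∣ S ∣ * cnt 𝓕 S ≤ P) →
                (d + 1) * P < n * length 𝓕 → P < n * length (𝓕 ∖ D)
    survivors {d = d} 𝓕 D D≤d bound large = +-cancelʳ-< (d * P) _ _ (begin-strict
      P + d * P                              ≡⟨ cong (_* P) (+-comm 1 d) ⟩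
      (d + 1) * P                            <⟨ large ⟩
      n * length 𝓕                           ≤⟨ length-∖ {a = n} 𝓕 D degrees ⟩
      n * length (𝓕 ∖ D) + length D * P      ≤⟨ +-monoʳ-≤ (n * length (𝓕 ∖ D)) (*-monoˡ-≤ P D≤d) ⟩
      n * length (𝓕 ∖ D) + d * P             ∎)
      where
      open ≤-Reasoning
      degrees : ∀ v → n * cnt 𝓕 ⁅ v ⁆ ≤ P
      degrees v = subst (λ u → u * cnt 𝓕 ⁅ v ⁆ ≤ P)
        (trans (cong (n ^_) (∣⁅x⁆∣≡1 v)) (*-identityʳ n)) (bound ⁅ v ⁆)

  -- Each family is first deprived of the stems found so far; at most toℕ i of
  -- them precede 𝓕 i, so more than P / n members survive.
  findStems : ∀ {m} d (𝓕 : Fin m → List (Subset N)) D → length D ≤ d →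
              (∀ i S → n ^ ∣ S ∣ * cnt (𝓕 i) S ≤ P) →
              (∀ i → (d + suc (toℕ i)) * P < n * length (𝓕 i)) → Stems R s 𝓕 D
  findStems {m = zero} d 𝓕 D _ _ _ = record
    { B = λ () ; 𝓔 = λ () ; light = [] ; heavy = [] ; stems = [] ; E∪B∈F = λ () ; B-disjoint = λ { {()} }
    ; B∩D = λ { {()} } ; B⊆stems = λ { {()} } ; stems≤ = z≤n ; light-robust = λ () ; heavy-robust = λ ()
    ; cover = λ () ; count = refl }
  findStems {N} {suc m} d 𝓕 D D≤d bound large
    with anyFin? (λ v → 3 * s * P ≤? n ^ 2 * cnt (𝓕 zero ∖ D) ⁅ v ⁆)
  ... | no none = record
    { B = B′
    ; 𝓔 = 𝓔′
    ; light = zero ∷ map suc light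
    ; heavy = map suc heavy
    ; stems = stems
    ; E∪B∈F = λ { zero A∈ → subst (_∈ₗ 𝓕 zero) (sym (∪-identityʳ _)) (proj₁ (∈-∖⁻ D A∈))
                ; (suc i) → E∪B∈F i }
    ; B-disjoint = B-disjoint′
    ; B∩D = λ { {zero} x∈ → ⊥-elim (∉⊥ x∈) ; {suc i} → B∩D }
    ; B⊆stems = λ { {zero} x∈ → ⊥-elim (∉⊥ x∈) ; {suc i} → B⊆stems }
    ; stems≤ = ≤-trans stems≤ (≤-reflexive (sym (length-map suc heavy)))
    ; light-robust = λ { (here refl) → light-is-robust (𝓕 zero ∖ D)
                           (λ S → ≤-trans (*-monoʳ-≤ (n ^ ∣ S ∣) (cnt-∖ (𝓕 zero) D S)) (bound zero S))
                           (survivors (𝓕 zero) D D≤d (bound zero) (large zero))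
                           (λ v → <⇒≤ (≰⇒> λ h → none (v , h)))
                       ; (there i∈) → tail-robust 𝓔′ light-robust i∈ }
    ; heavy-robust = tail-robust 𝓔′ heavy-robust
    ; cover = λ { zero → inj₁ (here refl)
                ; (suc i) → [ inj₁ ∘ there ∘ ∈-map⁺ suc , inj₂ ∘ ∈-map⁺ suc ]′ (cover i) }
    ; count = cong suc (trans (cong₂ _+_ (length-map suc light) (length-map suc heavy)) count) }
    where
    -- `d` counts the families passed, not the stems found, so it grows although `D` is unchanged.
    open Stems (findStems (suc d) (𝓕 ∘ suc) D (m≤n⇒m≤1+n D≤d) (bound ∘ suc)
                 (λ i → subst (λ u → u * P < n * length (𝓕 (suc i))) (+-suc d (suc (toℕ i))) (large (suc i))))
    𝓔′ : Fin (suc m) → List (Subset N)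
    𝓔′ zero    = 𝓕 zero ∖ D
    𝓔′ (suc i) = 𝓔 i
    B′ : Fin (suc m) → Subset N
    B′ zero    = ⊥
    B′ (suc i) = B i
    B-disjoint′ : ∀ {i j x} → x ∈ B′ i → x ∈ B′ j → i ≡ j
    B-disjoint′ {zero}          p _ = ⊥-elim (∉⊥ p)
    B-disjoint′ {suc i} {zero}  _ q = ⊥-elim (∉⊥ q)
    B-disjoint′ {suc i} {suc j} p q = cong suc (B-disjoint p q)
  ... | yes (v , heavy-v) = record
    { B = B′
    ; 𝓔 = 𝓔′
    ; light = map suc light
    ; heavy = zero ∷ map suc heavy
    ; stems = v ∷ stems
    ; E∪B∈F = λ { zero A∈ → proj₁ (∈-∖⁻ D (proj₁ (∈-link⁻ (𝓕 zero ∖ D) ⁅ v ⁆ A∈)))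
                ; (suc i) → E∪B∈F i }
    ; B-disjoint = B-disjoint′
    ; B∩D = λ { {zero} x∈ x∈D → v∉D (subst (_∈ₗ D) (x∈⁅y⁆⇒x≡y v x∈) x∈D)
              ; {suc i} x∈ x∈D → B∩D x∈ (there x∈D) }
    ; B⊆stems = λ { {zero} x∈ → here (x∈⁅y⁆⇒x≡y v x∈) ; {suc i} x∈ → there (B⊆stems x∈) }
    ; stems≤ = s≤s (≤-trans stems≤ (≤-reflexive (sym (length-map suc heavy))))
    ; light-robust = tail-robust 𝓔′ light-robust
    ; heavy-robust = λ { (here refl) → heavy-is-robust (𝓕 zero ∖ D)
                           (λ S → ≤-trans (*-monoʳ-≤ (n ^ ∣ S ∣) (cnt-∖ (𝓕 zero) D S)) (bound zero S)) v heavy-v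
                       ; (there i∈) → tail-robust 𝓔′ heavy-robust i∈ }
    ; cover = λ { zero → inj₂ (here refl)
                ; (suc i) → [ inj₁ ∘ ∈-map⁺ suc , inj₂ ∘ there ∘ ∈-map⁺ suc ]′ (cover i) }
    ; count = trans (cong₂ (λ a b → a + suc b) (length-map suc light) (length-map suc heavy))
                    (trans (+-suc _ _) (cong suc count)) }
    where
    open Stems (findStems (suc d) (𝓕 ∘ suc) (v ∷ D) (s≤s D≤d) (bound ∘ suc)
                 (λ i → subst (λ u → u * P < n * length (𝓕 (suc i))) (+-suc d (suc (toℕ i))) (large (suc i))))
    𝓔′ : Fin (suc m) → List (Subset N)
    𝓔′ zero    = link (𝓕 zero ∖ D) ⁅ v ⁆
    𝓔′ (suc i) = 𝓔 i
    B′ : Fin (suc m) → Subset N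
    B′ zero    = ⁅ v ⁆
    B′ (suc i) = B i
    B-disjoint′ : ∀ {i j x} → x ∈ B′ i → x ∈ B′ j → i ≡ j
    B-disjoint′ {zero}  {zero}  _ _ = refl
    B-disjoint′ {zero}  {suc j} p q = contradiction (here (x∈⁅y⁆⇒x≡y v p)) (B∩D q)
    B-disjoint′ {suc i} {zero}  p q = contradiction (here (x∈⁅y⁆⇒x≡y v q)) (B∩D p)
    B-disjoint′ {suc i} {suc j} p q = cong suc (B-disjoint p q)
    -- `v` has positive degree in a family from which `D` is already deleted, because 3sP > 0.
    v∉D : v ∉ₗ D
    v∉D v∈D with cnt (𝓕 zero ∖ D) ⁅ v ⁆ in eq
    ... | zero  = n≮0 (≤-trans (*-mono-≤ (*-mono-≤ {1} {3} (s≤s z≤n) 1≤s) 0<P)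
                    (≤-trans heavy-v (≤-reflexive (*-zeroʳ (n ^ 2)))))
    ... | suc _ = let A , A∈ = 0<length⇒∈ _ (subst (0 <_) (sym eq) (s≤s z≤n))
                      A∈′ , v∈A = ∈-filter⁻ (⁅ v ⁆ ⊆?_) {xs = 𝓕 zero ∖ D} A∈
                  in proj₂ (∈-∖⁻ D A∈′) v∈D (v∈A (x∈⁅x⁆ v))

-- Deleting stems and cores, and assembling the matching

-- Each vertex lies in at most a fraction 1/(2r) of the members, so at most half of them are lost.
-- For nonempty `T` the factor 2^|T| ≥ 2 between the two spread conditions makes up for this.
spread-∖ : ∀ {r} .{{_ : NonZero r}} (𝓐 : List (Subset N)) D → length D ≤ r → 0 < length 𝓐 →
           Spread (2 * r) 𝓐 → 0 < length (𝓐 ∖ D) × Spread r (𝓐 ∖ D)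
spread-∖ {r = r} 𝓐 D D≤r 0<𝓐 spread = 0<∖ (length (𝓐 ∖ D)) half , spread′
  where
  open ≤-Reasoning
  l = length 𝓐
  l′ = length (𝓐 ∖ D)
  degrees : ∀ v → 2 * r * cnt 𝓐 ⁅ v ⁆ ≤ l
  degrees v = subst (λ u → u * cnt 𝓐 ⁅ v ⁆ ≤ l)
    (trans (cong ((2 * r) ^_) (∣⁅x⁆∣≡1 v)) (*-identityʳ (2 * r))) (spread ⁅ v ⁆)
  half : l ≤ 2 * l′
  half = *-cancelˡ-≤ r (+-cancelʳ-≤ (r * l) _ _ (begin
    r * l + r * l                 ≡⟨ lem₁ r l ⟩
    2 * r * l                     ≤⟨ length-∖ {a = 2 * r} 𝓐 D degrees ⟩
    2 * r * l′ + length D * l     ≤⟨ +-monoʳ-≤ (2 * r * l′) (*-monoˡ-≤ l D≤r) ⟩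
    2 * r * l′ + r * l            ≡⟨ cong (_+ r * l) (lem₂ r l′) ⟩
    r * (2 * l′) + r * l          ∎))
    where
    lem₁ : ∀ r l → r * l + r * l ≡ 2 * r * l
    lem₁ = solve-∀
    lem₂ : ∀ r l → 2 * r * l ≡ r * (2 * l)
    lem₂ = solve-∀
  0<∖ : ∀ l′ → l ≤ 2 * l′ → 0 < l′
  0<∖ zero    l≤0 = contradiction (≤-trans 0<𝓐 l≤0) λ ()
  0<∖ (suc _) _   = s≤s z≤n
  spread′ : Spread r (𝓐 ∖ D)
  spread′ T with ∣ T ∣ | spread T
  ... | zero  | _     = ≤-trans (≤-reflexive (+-identityʳ _)) (length-filter (T ⊆?_) (𝓐 ∖ D))
  ... | suc t | bound = *-cancelˡ-≤ 2 (begin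
    2 * (r ^ suc t * cnt (𝓐 ∖ D) T)        ≡⟨ *-assoc 2 (r ^ suc t) _ ⟨
    2 * r ^ suc t * cnt (𝓐 ∖ D) T          ≤⟨ *-mono-≤ (*-monoˡ-≤ (r ^ suc t) (*-monoʳ-≤ 2 (m^n>0 2 t))) (cnt-∖ 𝓐 D T) ⟩
    2 ^ suc t * r ^ suc t * cnt 𝓐 T        ≡⟨ cong (_* cnt 𝓐 T) (sym (^-distribʳ-* (suc t) 2 r)) ⟩
    (2 * r) ^ suc t * cnt 𝓐 T              ≤⟨ bound ⟩
    l                                      ≤⟨ half ⟩
    2 * l′                                 ∎)

-- With g light and h heavy families, the light cores come first: stems and light cores take at most
-- h + 2g ≤ 2m vertices, within the tolerance of light families. The heavy cores bring the total to
-- at most 3h + 2g ≤ 3m.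
module Assembly {r m} .{{_ : NonZero r}} (0<m : 0 < m) (3m≤r : 3 * m ≤ r)
                {𝓕 : Fin m → List (Subset N)} (st : Stems (2 * r) m 𝓕 []) where
  open ≤-Reasoning
  open Stems st

  light-budget : length stems + length light * 2 ≤ 2 * m + 2
  light-budget = begin
    length stems + length light * 2                  ≤⟨ +-monoˡ-≤ _ stems≤ ⟩
    length heavy + length light * 2                  ≤⟨ m≤m+n _ (length heavy) ⟩
    length heavy + length light * 2 + length heavy   ≡⟨ lem (length light) (length heavy) ⟩
    2 * (length light + length heavy)                ≡⟨ cong (2 *_) count ⟩
    2 * m                                        ≤⟨ m≤m+n _ 2 ⟩
    2 * m + 2                                    ∎
    where
    lem : ∀ g h → h + g * 2 + h ≡ 2 * (g + h)
    lem = solve-∀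

  lights : Greedy (2 * r) 𝓔 light stems
  lights = greedy 𝓔 light stems light-robust light-budget
  module L = Greedy lights

  all-used≤ : length (L.used ++ stems) + length heavy * 2 ≤ 3 * m
  all-used≤ = begin
    length (L.used ++ stems) + length heavy * 2                  ≡⟨ cong (_+ length heavy * 2) (length-++ L.used) ⟩
    length L.used + length stems + length heavy * 2              ≤⟨ +-monoˡ-≤ _ (+-mono-≤ L.used≤ stems≤) ⟩
    length light * 2 + length heavy + length heavy * 2           ≤⟨ m≤m+n _ (length light) ⟩
    length light * 2 + length heavy + length heavy * 2 + length light
                                                                 ≡⟨ lem (length light) (length heavy) ⟩
    3 * (length light + length heavy)                            ≡⟨ cong (3 *_) count ⟩
    3 * m                                                    ∎
    where
    lem : ∀ g h → g * 2 + h + h * 2 + g ≡ 3 * (g + h)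
    lem = solve-∀

  heavies : Greedy (2 * r) 𝓔 heavy (L.used ++ stems)
  heavies = greedy 𝓔 heavy (L.used ++ stems) heavy-robust
    -- `0 < m` gives 2 ≤ 3m, so the truncated subtraction is exact.
    (≤-trans all-used≤ (≤-reflexive (sym (m∸n+n≡m (≤-trans (n≤1+n 2) (*-monoʳ-≤ 3 0<m))))))
  module H = Greedy heavies

  coreOf : ∀ i → i ∈ₗ light ⊎ i ∈ₗ heavy → Core (2 * r) (𝓔 i) stems
  coreOf i (inj₁ i∈) = L.cores i∈
  coreOf i (inj₂ i∈) = weaken L.used (H.cores i∈)

  coreAt : ∀ i → Core (2 * r) (𝓔 i) stems
  coreAt i = coreOf i (cover i)

  S-disjoint : ∀ {i j x} p q → x ∈ S (coreOf i p) → x ∈ S (coreOf j q) → i ≡ j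
  S-disjoint (inj₁ i∈) (inj₁ j∈) x∈ x∈′ = L.disjoint i∈ j∈ x∈ x∈′
  S-disjoint (inj₂ i∈) (inj₂ j∈) x∈ x∈′ = H.disjoint i∈ j∈ x∈ x∈′
  -- Heavy cores were chosen to avoid everything in `L.used`.
  S-disjoint (inj₁ i∈) (inj₂ j∈) x∈ x∈′ =
    contradiction (∈-++⁺ˡ (L.S⊆used i∈ x∈)) (S∩D (H.cores j∈) x∈′)
  S-disjoint (inj₂ i∈) (inj₁ j∈) x∈ x∈′ =
    contradiction (∈-++⁺ˡ (L.S⊆used j∈ x∈′)) (S∩D (H.cores i∈) x∈)

  -- All vertices of stems and cores; petals avoiding `U` can meet the final sets of other families
  -- only in petals.
  U : List (Fin N)
  U = H.used ++ (L.used ++ stems)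

  S⊆U : ∀ {i x} p → x ∈ S (coreOf i p) → x ∈ₗ U
  S⊆U (inj₁ i∈) x∈ = ∈-++⁺ʳ H.used (∈-++⁺ˡ (L.S⊆used i∈ x∈))
  S⊆U (inj₂ i∈) x∈ = ∈-++⁺ˡ (H.S⊆used i∈ x∈)

  B⊆U : ∀ {i x} → x ∈ B i → x ∈ₗ U
  B⊆U x∈ = ∈-++⁺ʳ H.used (∈-++⁺ʳ L.used (B⊆stems x∈))

  U≤r : length U ≤ r
  U≤r = begin
    length U                                          ≡⟨ length-++ H.used ⟩
    length H.used + length (L.used ++ stems)          ≤⟨ +-monoˡ-≤ _ H.used≤ ⟩
    length heavy * 2 + length (L.used ++ stems)       ≡⟨ +-comm (length heavy * 2) _ ⟩
    length (L.used ++ stems) + length heavy * 2       ≤⟨ all-used≤ ⟩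
    3 * m                                             ≤⟨ 3m≤r ⟩
    r                                                 ∎

  𝓟 : Fin (m) → List (Subset N)
  𝓟 i = petals (coreAt i) ∖ U

  sparse : ∀ i → 0 < length (𝓟 i) × Spread r (𝓟 i)
  sparse i = spread-∖ (petals (coreAt i)) U U≤r (nonempty (coreAt i)) (spread (coreAt i))

  assemble : ∀ i {A} → A ∈ₗ 𝓟 i → (A ∪ S (coreAt i)) ∪ B i ∈ₗ 𝓕 i
  assemble i A∈ = E∪B∈F i (petal∪S (coreAt i) (proj₁ (∈-∖⁻ U A∈)))

  module _ {A : Fin m → Subset N} (A∈ : ∀ i → A i ∈ₗ 𝓟 i)
           (A-disjoint : ∀ {i j x} → x ∈ A i → x ∈ A j → i ≡ j) where

    A∩U : ∀ {i x} → x ∈ A i → x ∉ₗ U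
    A∩U {i} x∈A x∈U = proj₂ (∈-∖⁻ U (A∈ i)) x∈U x∈A

    C : Fin (m) → Subset N
    C i = (A i ∪ S (coreAt i)) ∪ B i

    C∈ : ∀ i → C i ∈ₗ 𝓕 i
    C∈ i = assemble i (A∈ i)

    x∈C⁻ : ∀ i {x} → x ∈ C i → x ∈ A i ⊎ x ∈ S (coreAt i) ⊎ x ∈ B i
    x∈C⁻ i x∈ = [ (λ x∈A∪S → [ inj₁ , inj₂ ∘ inj₁ ]′ (x∈p∪q⁻ (A i) (S (coreAt i)) x∈A∪S)) , inj₂ ∘ inj₂ ]′
                  (x∈p∪q⁻ (A i ∪ S (coreAt i)) (B i) x∈)

    parts-disjoint : ∀ {i j x} → x ∈ A i ⊎ x ∈ S (coreAt i) ⊎ x ∈ B i →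
                     x ∈ A j ⊎ x ∈ S (coreAt j) ⊎ x ∈ B j → i ≡ j
    parts-disjoint         (inj₁ a)        (inj₁ a′)        = A-disjoint a a′
    parts-disjoint {j = j} (inj₁ a)        (inj₂ (inj₁ c))  = contradiction (S⊆U (cover j) c) (A∩U a)
    parts-disjoint         (inj₁ a)        (inj₂ (inj₂ b))  = contradiction (B⊆U b) (A∩U a)
    parts-disjoint {i}     (inj₂ (inj₁ c)) (inj₁ a)         = contradiction (S⊆U (cover i) c) (A∩U a)
    parts-disjoint {i} {j} (inj₂ (inj₁ c)) (inj₂ (inj₁ c′)) = S-disjoint (cover i) (cover j) c c′
    parts-disjoint {i}     (inj₂ (inj₁ c)) (inj₂ (inj₂ b))  = contradiction (B⊆stems b) (S∩D (coreAt i) c)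
    parts-disjoint         (inj₂ (inj₂ b)) (inj₁ a)         = contradiction (B⊆U b) (A∩U a)
    parts-disjoint {j = j} (inj₂ (inj₂ b)) (inj₂ (inj₁ c))  = contradiction (B⊆stems b) (S∩D (coreAt j) c)
    parts-disjoint         (inj₂ (inj₂ b)) (inj₂ (inj₂ b′)) = B-disjoint b b′

    C-disjoint : ∀ {i j x} → x ∈ C i → x ∈ C j → i ≡ j
    C-disjoint {i} {j} p q = parts-disjoint (x∈C⁻ i p) (x∈C⁻ j q)

-- `P` stands for n^k. Cores are chosen with spread 2r, and deleting the used vertices leaves r =
-- 4β(s + 1), precisely what `spread-matching` takes.
rainbow : ∀ {s β k n P} → let r = 4 * (β * suc s) in
  1 ≤ s → 1 ≤ β → suc s * k < 2 ^ β → 4 * (2 * r) ^ 3 ≤ n ^ 2 → 8 * suc s ^ 2 ≤ n → 0 < P →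
  (𝓕 : Fin (suc s) → List (Subset N)) →
  (∀ i {A} → A ∈ₗ 𝓕 i → ∣ A ∣ ≤ k) →
  (∀ i S → n ^ ∣ S ∣ * cnt (𝓕 i) S ≤ P) →
  (∀ i → suc (toℕ i) * P < n * length (𝓕 i)) →
  ∃ λ (C : Fin (suc s) → Subset N) →
    (∀ i → C i ∈ₗ 𝓕 i) × (∀ {i j x} → x ∈ C i → x ∈ C j → i ≡ j)
rainbow {s = s} {β} {k} {n} {P} 1≤s 1≤β sk<2^β 4R³≤n² 8s²≤n 0<P 𝓕 ∣A∣≤k bound large =
  let A , A∈ , A-disjoint = spread-matching 1≤s 1≤β sk<2^β 𝓟 (proj₁ ∘ sparse)
        (λ i {A} A∈ → ≤-trans (≤-trans (∣p∣≤∣p∪q∣ A (S (coreAt i))) (∣p∣≤∣p∪q∣ (A ∪ S (coreAt i)) (B i)))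
                              (∣A∣≤k i (assemble i A∈)))
        (proj₂ ∘ sparse)
  in C A∈ A-disjoint , C∈ A∈ A-disjoint , C-disjoint A∈ A-disjoint
  where
  r = 4 * (β * suc s)
  instance
    β≢0 : NonZero β
    β≢0 = >-nonZero 1≤β
    r≢0 : NonZero r
    r≢0 = m*n≢0 4 (β * suc s) {{_}} {{m*n≢0 β (suc s)}}
  st : Stems (2 * r) (suc s) 𝓕 []
  st = findStems {s = suc s} {P} (≤-trans (>-nonZero⁻¹ r) (m≤m+n r _)) 4R³≤n² (s≤s z≤n) 8s²≤n 0<P
                 0 𝓕 [] z≤n bound large
  open Stems st using (B)
  open Assembly (s≤s z≤n) (*-mono-≤ (n≤1+n 3) (m≤n*m (suc s) β)) st

-- Encoding of tuples

∑-++ : ∀ (xs ys : List X) f → ∑ (xs ++ ys) f ≡ ∑ xs f + ∑ ys f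
∑-++ xs ys f = trans (cong sum (map-++ f xs ys)) (sum-++ (map f xs) (map f ys))

-- Each `x` is removed from `ys` once it is matched; by uniqueness the remaining entries of `xs` are
-- still found there.
∑-Unique : ∀ {xs : List X} → Unique xs → ∀ ys → (∀ {x} → x ∈ₗ xs → x ∈ₗ ys) → ∀ f → ∑ xs f ≤ ∑ ys f
∑-Unique []                          ys sub f = z≤n
∑-Unique {xs = x ∷ xs} (x∉xs ∷ unique) ys sub f with ys₁ , ys₂ , refl ← ∈-∃++ (sub (here refl)) = begin
  f x + ∑ xs f                     ≤⟨ +-monoʳ-≤ (f x) (∑-Unique unique (ys₁ ++ ys₂) sub′ f) ⟩
  f x + ∑ (ys₁ ++ ys₂) f           ≡⟨ cong (f x +_) (∑-++ ys₁ ys₂ f) ⟩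
  f x + (∑ ys₁ f + ∑ ys₂ f)        ≡⟨ lem (f x) (∑ ys₁ f) (∑ ys₂ f) ⟩
  ∑ ys₁ f + (f x + ∑ ys₂ f)        ≡⟨ ∑-++ ys₁ (x ∷ ys₂) f ⟨
  ∑ (ys₁ ++ x ∷ ys₂) f             ∎
  where
  open ≤-Reasoning
  lem : ∀ a b c → a + (b + c) ≡ b + (a + c)
  lem = solve-∀
  sub′ : ∀ {y} → y ∈ₗ xs → y ∈ₗ ys₁ ++ ys₂
  sub′ y∈ with ∈-++⁻ ys₁ (sub (there y∈))
  ... | inj₁ y∈₁         = ∈-++⁺ˡ y∈₁
  ... | inj₂ (there y∈₂) = ∈-++⁺ʳ ys₁ y∈₂
  ... | inj₂ (here refl) = contradiction refl (All.lookup x∉xs y∈)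

∑-cartesianProductWith≤ : ∀ (c : X → Y → Z) xs ys {f : Z → ℕ} {g : X → ℕ} {h : Y → ℕ} →
  (∀ x y → f (c x y) ≤ g x * h y) → ∑ (cartesianProductWith c xs ys) f ≤ ∑ xs g * ∑ ys h
∑-cartesianProductWith≤ c []       ys bound = z≤n
∑-cartesianProductWith≤ c (x ∷ xs) ys {f} {g} {h} bound = begin
  ∑ (map (c x) ys ++ cartesianProductWith c xs ys) f      ≡⟨ ∑-++ (map (c x) ys) _ f ⟩
  ∑ (map (c x) ys) f + ∑ (cartesianProductWith c xs ys) f ≤⟨ +-mono-≤ row (∑-cartesianProductWith≤ c xs ys bound) ⟩
  g x * ∑ ys h + ∑ xs g * ∑ ys h                          ≡⟨ *-distribʳ-+ (∑ ys h) (g x) (∑ xs g) ⟨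
  (g x + ∑ xs g) * ∑ ys h                                 ∎
  where
  open ≤-Reasoning
  row : ∑ (map (c x) ys) f ≤ g x * ∑ ys h
  row = begin
    ∑ (map (c x) ys) f         ≡⟨ ∑-map (c x) ys f ⟩
    ∑ ys (f ∘ c x)             ≤⟨ ∑-mono ys (λ {y} _ → bound x y) ⟩
    ∑ ys (λ y → g x * h y)     ≡⟨ ∑-*ˡ ys (g x) h ⟩
    g x * ∑ ys h               ∎

tuples : ∀ n k → List (Tuple n k)
tuples n zero    = [] ∷ []
tuples n (suc k) = cartesianProductWith _∷_ (allFin n) (tuples n k)

∈-tuples : (x : Tuple n k) → x ∈ₗ tuples n k
∈-tuples []      = here refl
∈-tuples (a ∷ x) = ∈-cartesianProductWith⁺ _∷_ (∈-allFin a) (∈-tuples x)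

-- The indicator vector of {(j, x_j)}, written as k blocks of length n; `combine` numbers the points
-- in the same order.
encode : Tuple n k → Subset (k * n)
encode []      = []
encode (a ∷ x) = ⁅ a ⁆ Vec.++ encode x

∈-++ˡ⁺ : ∀ {m} {p : Subset N} {q : Subset m} {a} → a ∈ p → a ↑ˡ m ∈ p Vec.++ q
∈-++ˡ⁺ Vec.here       = Vec.here
∈-++ˡ⁺ (Vec.there a∈) = Vec.there (∈-++ˡ⁺ a∈)

∈-++ˡ⁻ : ∀ {m} (p : Subset N) {q : Subset m} {a} → a ↑ˡ m ∈ p Vec.++ q → a ∈ p
∈-++ˡ⁻ (_ ∷ p) {a = zero}  Vec.here       = Vec.here
∈-++ˡ⁻ (_ ∷ p) {a = suc a} (Vec.there a∈) = Vec.there (∈-++ˡ⁻ p a∈)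

∈-++ʳ⁺ : ∀ {m} (p : Subset N) {q : Subset m} {a} → a ∈ q → N ↑ʳ a ∈ p Vec.++ q
∈-++ʳ⁺ []      a∈ = a∈
∈-++ʳ⁺ (_ ∷ p) a∈ = Vec.there (∈-++ʳ⁺ p a∈)

∈-++ʳ⁻ : ∀ {m} (p : Subset N) {q : Subset m} {a} → N ↑ʳ a ∈ p Vec.++ q → a ∈ q
∈-++ʳ⁻ []      a∈             = a∈
∈-++ʳ⁻ (_ ∷ p) (Vec.there a∈) = ∈-++ʳ⁻ p a∈

∣p++q∣ : ∀ {m} (p : Subset N) (q : Subset m) → ∣ p Vec.++ q ∣ ≡ ∣ p ∣ + ∣ q ∣
∣p++q∣ []            q = refl
∣p++q∣ (inside  ∷ p) q = cong suc (∣p++q∣ p q)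
∣p++q∣ (outside ∷ p) q = ∣p++q∣ p q

∣encode∣ : (x : Tuple n k) → ∣ encode x ∣ ≡ k
∣encode∣ []      = refl
∣encode∣ (a ∷ x) = trans (∣p++q∣ ⁅ a ⁆ (encode x)) (cong₂ _+_ (∣⁅x⁆∣≡1 a) (∣encode∣ x))

∈-encode : ∀ (x : Tuple n k) j → combine j (lookup x j) ∈ encode x
∈-encode (a ∷ x) zero    = ∈-++ˡ⁺ (x∈⁅x⁆ a)
∈-encode (a ∷ x) (suc j) = ∈-++ʳ⁺ ⁅ a ⁆ (∈-encode x j)

∑-allFin : ∀ n f → ∑ (allFin (suc n)) f ≡ f zero + ∑ (allFin n) (f ∘ suc)
∑-allFin n f = cong (λ xs → f zero + sum xs) (trans (map-tabulate suc f) (sym (map-tabulate id (f ∘ suc))))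

count-⊆⁅⁆ : ∀ (p : Subset N) → 1 ≤ ∣ p ∣ → ∑ (allFin N) (λ a → ⟦ p ⊆? ⁅ a ⁆ ⟧) ≤ 1
count-⊆⁅⁆ {suc N} (inside ∷ p) _ = begin
  ∑ (allFin (suc N)) (λ a → ⟦ inside ∷ p ⊆? ⁅ a ⁆ ⟧)       ≡⟨ ∑-allFin N (λ a → ⟦ inside ∷ p ⊆? ⁅ a ⁆ ⟧) ⟩
  ⟦ inside ∷ p ⊆? inside ∷ ⊥ ⟧ + ∑ (allFin N) (λ a → ⟦ inside ∷ p ⊆? outside ∷ ⁅ a ⁆ ⟧)
    ≤⟨ +-mono-≤ (⟦⟧≤1 (inside ∷ p ⊆? inside ∷ ⊥)) (∑-mono (allFin N) λ {a} _ →
         ≤-reflexive (⟦⟧-no (inside ∷ p ⊆? outside ∷ ⁅ a ⁆) (λ sub → head∉ (sub Vec.here)))) ⟩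
  1 + ∑ (allFin N) (λ _ → 0)                               ≡⟨ cong suc (trans (∑-const (allFin N) 0) (*-zeroʳ (length (allFin N)))) ⟩
  1                                                        ∎
  where
  open ≤-Reasoning
  head∉ : ∀ {q : Subset N} → ¬ (Fin.zero ∈ outside ∷ q)
  head∉ ()
count-⊆⁅⁆ {suc N} (outside ∷ p) 1≤∣p∣ = begin
  ∑ (allFin (suc N)) (λ a → ⟦ outside ∷ p ⊆? ⁅ a ⁆ ⟧)      ≡⟨ ∑-allFin N (λ a → ⟦ outside ∷ p ⊆? ⁅ a ⁆ ⟧) ⟩
  ⟦ outside ∷ p ⊆? inside ∷ ⊥ ⟧ + ∑ (allFin N) (λ a → ⟦ outside ∷ p ⊆? outside ∷ ⁅ a ⁆ ⟧)
    ≤⟨ +-mono-≤ (≤-reflexive (⟦⟧-no (outside ∷ p ⊆? inside ∷ ⊥) λ sub →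
                  n≮0 (≤-trans 1≤∣p∣ (≤-trans (p⊆q⇒∣p∣≤∣q∣ (drop-∷-⊆ sub)) (≤-reflexive (∣⊥∣≡0 N))))))
                (∑-mono (allFin N) λ {a} _ → ⟦⟧-mono (outside ∷ p ⊆? outside ∷ ⁅ a ⁆) (p ⊆? ⁅ a ⁆) drop-∷-⊆) ⟩
  ∑ (allFin N) (λ a → ⟦ p ⊆? ⁅ a ⁆ ⟧)                      ≤⟨ count-⊆⁅⁆ p 1≤∣p∣ ⟩
  1                                                        ∎
  where open ≤-Reasoning

-- The degree bound for one coordinate: the empty set lies in all n singletons, a one-point set in
-- one, a larger set in none.
n^∣p∣*count≤n : ∀ (p : Subset n) → n ^ ∣ p ∣ * ∑ (allFin n) (λ a → ⟦ p ⊆? ⁅ a ⁆ ⟧) ≤ n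
n^∣p∣*count≤n {n} p with ∣ p ∣ in eq
... | zero        = begin
  1 * ∑ (allFin n) (λ a → ⟦ p ⊆? ⁅ a ⁆ ⟧)     ≡⟨ *-identityˡ _ ⟩
  ∑ (allFin n) (λ a → ⟦ p ⊆? ⁅ a ⁆ ⟧)         ≤⟨ ∑-mono (allFin n) (λ {a} _ → ⟦⟧≤1 (p ⊆? ⁅ a ⁆)) ⟩
  ∑ (allFin n) (λ _ → 1)                      ≡⟨ trans (∑-const (allFin n) 1) (*-identityʳ _) ⟩
  length (allFin n)                           ≡⟨ length-tabulate id ⟩
  n                                           ∎
  where open ≤-Reasoning
... | suc zero    = ≤-trans (*-monoʳ-≤ (n * 1) (count-⊆⁅⁆ p (≤-reflexive (sym eq))))
                            (≤-reflexive (trans (*-identityʳ (n * 1)) (*-identityʳ n)))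
... | suc (suc t) = ≤-trans (*-monoʳ-≤ (n ^ (2 + t)) (∑-mono (allFin n) λ {a} _ →
                      ≤-reflexive (⟦⟧-no (p ⊆? ⁅ a ⁆) λ sub →
                        n≮0 (s≤s⁻¹ (≤-trans (≤-reflexive (sym eq)) (≤-trans (p⊆q⇒∣p∣≤∣q∣ sub) (≤-reflexive (∣⁅x⁆∣≡1 a))))))))
                    (≤-trans (≤-reflexive (trans (cong (n ^ (2 + t) *_) (trans (∑-const (allFin n) 0) (*-zeroʳ (length (allFin n)))))
                                                 (*-zeroʳ (n ^ (2 + t))))) z≤n)

-- Containment can be tested block by block, so the count factors over the coordinates, and each
-- coordinate contributes at most n.
∑-tuples≤ : ∀ n k (S : Subset (k * n)) → n ^ ∣ S ∣ * ∑ (tuples n k) (λ x → ⟦ S ⊆? encode x ⟧) ≤ n ^ k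
∑-tuples≤ n zero    [] = ≤-refl
∑-tuples≤ n (suc k) S with p , q , refl ← splitAt n S = begin
  n ^ ∣ p Vec.++ q ∣ * ∑ (tuples n (suc k)) (λ x → ⟦ p Vec.++ q ⊆? encode x ⟧)
    ≤⟨ *-mono-≤ (≤-reflexive (trans (cong (n ^_) (∣p++q∣ p q)) (^-distribˡ-+-* n ∣ p ∣ ∣ q ∣)))
                (∑-cartesianProductWith≤ _∷_ (allFin n) (tuples n k) split) ⟩
  n ^ ∣ p ∣ * n ^ ∣ q ∣ * (∑ (allFin n) (λ a → ⟦ p ⊆? ⁅ a ⁆ ⟧) * ∑ (tuples n k) (λ x → ⟦ q ⊆? encode x ⟧))
    ≡⟨ [m*n]*[o*p]≡[m*o]*[n*p] (n ^ ∣ p ∣) _ _ _ ⟩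
  n ^ ∣ p ∣ * ∑ (allFin n) (λ a → ⟦ p ⊆? ⁅ a ⁆ ⟧) * (n ^ ∣ q ∣ * ∑ (tuples n k) (λ x → ⟦ q ⊆? encode x ⟧))
    ≤⟨ *-mono-≤ (n^∣p∣*count≤n p) (∑-tuples≤ n k q) ⟩
  n * n ^ k ∎
  where
  open ≤-Reasoning
  split : ∀ (a : Fin n) (x : Tuple n k) → ⟦ p Vec.++ q ⊆? ⁅ a ⁆ Vec.++ encode x ⟧ ≤ ⟦ p ⊆? ⁅ a ⁆ ⟧ * ⟦ q ⊆? encode x ⟧
  split a x with p Vec.++ q ⊆? ⁅ a ⁆ Vec.++ encode x
  ... | no _    = z≤n
  ... | yes sub = ≤-reflexive (sym (cong₂ _*_
    (⟦⟧-yes (p ⊆? ⁅ a ⁆) (λ x∈ → ∈-++ˡ⁻ ⁅ a ⁆ (sub (∈-++ˡ⁺ x∈))))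
    (⟦⟧-yes (q ⊆? encode x) (λ x∈ → ∈-++ʳ⁻ ⁅ a ⁆ (sub (∈-++ʳ⁺ p x∈))))))

cnt-family≤ : ∀ (F : Family n k) S → n ^ ∣ S ∣ * cnt (map encode (elems F)) S ≤ n ^ k
cnt-family≤ {n} {k} F S = ≤-trans (*-monoʳ-≤ (n ^ ∣ S ∣) (begin
  cnt (map encode (elems F)) S                        ≡⟨ length-filter≡∑ (S ⊆?_) (map encode (elems F)) ⟩
  ∑ (map encode (elems F)) (λ A → ⟦ S ⊆? A ⟧)         ≡⟨ ∑-map encode (elems F) _ ⟩
  ∑ (elems F) (λ x → ⟦ S ⊆? encode x ⟧)               ≤⟨ ∑-Unique (unique F) (tuples n k) (λ {x} _ → ∈-tuples x) _ ⟩
  ∑ (tuples n k) (λ x → ⟦ S ⊆? encode x ⟧)            ∎)) (∑-tuples≤ n k S)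
  where open ≤-Reasoning

-- The logarithmic hypothesis and the conclusion

2^-bracket : ∀ m → 1 ≤ m → ∃ λ β → 2 ^ β ≤ m × m < 2 ^ suc β
2^-bracket (suc zero)    _ = 0 , ≤-refl , ≤-refl
2^-bracket (suc (suc m)) _ with β , ≤m , m< ← 2^-bracket (suc m) (s≤s z≤n) with m≤n⇒m<n∨m≡n m<
... | inj₁ m+2<  = β , m≤n⇒m≤1+n ≤m , m+2<
... | inj₂ m+2≡  = suc β , ≤-reflexive (sym m+2≡) ,
                   ≤-trans (s≤s (≤-reflexive m+2≡)) (^-monoʳ-< 2 ≤-refl (n<1+n (suc β)))

-- LogCond at the exponent (3 + 4 β′) / 4, slightly below 1 + β′ ≤ log₂ (s k).
LogCond⇒4R³≤n² : ∀ {n k s} → LogCond n k s → ∀ β′ → 2 ^ suc β′ ≤ s * k →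
                 4 * (2 * (4 * ((2 + β′) * s))) ^ 3 ≤ n ^ 2
-- 512 = 8 · 64, where 64 = 4³ comes from the denominator 4 of the exponent and 8 = 2³ from
-- comparing `3 * β` with `2 * p`.
LogCond⇒4R³≤n² {n} {k} {s} logCond β′ 2^≤ = *-cancelˡ-≤ 512 (begin
  512 * (4 * (2 * (4 * (β * s))) ^ 3)       ≡⟨ cong (λ u → 512 * (4 * u)) (trans (^-distribʳ-* 3 2 (4 * (β * s)))
                                                 (cong (8 *_) (trans (^-distribʳ-* 3 4 (β * s))
                                                   (cong (64 *_) (^-distribʳ-* 3 β s))))) ⟩
  512 * (4 * (8 * (64 * (β ^ 3 * s ^ 3))))  ≡⟨ flatten 512 4 8 64 (β ^ 3 * s ^ 3) ⟩
  1048576 * (β ^ 3 * s ^ 3)                 ≡⟨ *-assoc 65536 16 (β ^ 3 * s ^ 3) ⟩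
  65536 * (16 * (β ^ 3 * s ^ 3))            ≡⟨ cong (65536 *_) (*-assoc 16 (β ^ 3) (s ^ 3)) ⟨
  65536 * (16 * β ^ 3 * s ^ 3)              ≤⟨ *-monoʳ-≤ 65536 (*-monoˡ-≤ (s ^ 3) 16β³≤8p³) ⟩
  65536 * (8 * p ^ 3 * s ^ 3)               ≡⟨ reorder 65536 8 (p ^ 3) (s ^ 3) ⟩
  8 * (65536 * s ^ 3 * p ^ 3)               ≤⟨ *-monoʳ-≤ 8 (logCond p 4 (s≤s z≤n) 2^p<) ⟩
  8 * (n ^ 2 * 64)                          ≡⟨ trans (cong (8 *_) (*-comm (n ^ 2) 64)) (sym (*-assoc 8 64 (n ^ 2))) ⟩
  512 * n ^ 2                               ∎)
  where
  open ≤-Reasoning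
  β = 2 + β′
  p = 3 + β′ * 4
  flatten : ∀ a b c d y → a * (b * (c * (d * y))) ≡ a * b * c * d * y
  flatten = solve-∀
  reorder : ∀ a b x y → a * (b * x * y) ≡ b * (a * y * x)
  reorder = solve-∀
  -- Equality holds at β′ = 0. Cubing gives 27β³ ≤ 8p³, and 27 ≥ 16.
  3β≤2p : 3 * β ≤ 2 * p
  3β≤2p = ≤-trans (m≤m+n (3 * β) (5 * β′)) (≤-reflexive (lem β′))
    where
    lem : ∀ b → 3 * (2 + b) + 5 * b ≡ 2 * (3 + b * 4)
    lem = solve-∀
  16β³≤8p³ : 16 * β ^ 3 ≤ 8 * p ^ 3
  16β³≤8p³ = begin
    16 * β ^ 3       ≤⟨ *-monoˡ-≤ (β ^ 3) (m≤m+n 16 11) ⟩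
    27 * β ^ 3       ≡⟨ ^-distribʳ-* 3 3 β ⟨
    (3 * β) ^ 3      ≤⟨ ^-monoˡ-≤ 3 3β≤2p ⟩
    (2 * p) ^ 3      ≡⟨ ^-distribʳ-* 3 2 p ⟩
    8 * p ^ 3        ∎
  2^p< : 2 ^ p < (s * k) ^ 4
  2^p< = begin-strict
    2 ^ p                <⟨ ^-monoʳ-< 2 ≤-refl (n<1+n p) ⟩
    2 ^ (suc β′ * 4)     ≡⟨ ^-*-assoc 2 (suc β′) 4 ⟨
    (2 ^ suc β′) ^ 4     ≤⟨ ^-monoˡ-≤ 4 2^≤ ⟩
    (s * k) ^ 4          ∎

-- Two tuples that agree in coordinate l share the point numbered by l and their common entry.
decode-matching : ∀ {s} (ℱ : Fin s → Family n k) {C : Fin s → Subset (k * n)} →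
                  (∀ i → C i ∈ₗ map encode (elems (ℱ i))) →
                  (∀ {i j x} → x ∈ C i → x ∈ C j → i ≡ j) → RainbowMatching ℱ
decode-matching ℱ {C} C∈ C-disjoint =
  tuple , (λ i → proj₁ (proj₂ (∈-map⁻ encode (C∈ i)))) ,
  λ i j i≢j l eq → i≢j (C-disjoint (point∈ i l) (subst (λ a → combine l a ∈ C j) (sym eq) (point∈ j l)))
  where
  tuple : ∀ i → Tuple _ _
  tuple i = proj₁ (∈-map⁻ encode (C∈ i))
  point∈ : ∀ i l → combine l (lookup (tuple i) l) ∈ C i
  point∈ i l = subst (combine l (lookup (tuple i) l) ∈_)
    (sym (proj₂ (proj₂ (∈-map⁻ encode (C∈ i))))) (∈-encode (tuple i) l)

theorem1 : (n k s : ℕ) → 1 ≤ n → 1 ≤ k → 1 ≤ s →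
    LogCond n k s → 8 * s ^ 2 ≤ n →
    (ℱ : Fin s → Family n k) →
    ((i : Fin s) → suc (toℕ i) * n ^ (k ∸ 1) < size (ℱ i)) →
    RainbowMatching ℱ
theorem1 n k 1 1≤n 1≤k 1≤s logCond 8s²≤n ℱ large =
  -- For one family any member will do; the random colouring uses at least two colours.
  (λ i → proj₁ (member i)) , (λ i → proj₂ (member i)) , λ { zero zero 0≢0 → contradiction refl 0≢0 }
  where
  member : ∀ i → ∃ λ x → x ∈ₗ elems (ℱ i)
  member i = 0<length⇒∈ (elems (ℱ i)) (≤-trans (s≤s z≤n) (large i))
theorem1 n (suc k) (suc (suc s)) 1≤n 1≤k 1≤s logCond 8s²≤n ℱ large =
  main (2^-bracket (suc (suc s) * suc k) (s≤s z≤n))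
  where
  instance
    n≢0 : NonZero n
    n≢0 = >-nonZero 1≤n
  -- Multiplying by n turns n^(k - 1) into P = n^k, with `suc k` in the role of k.
  sizes : ∀ i → suc (toℕ i) * n ^ suc k < n * length (map encode (elems (ℱ i)))
  sizes i = subst₂ _<_ (x∙yz≈y∙xz *-commutativeSemigroup n (suc (toℕ i)) (n ^ k))
                       (cong (n *_) (sym (length-map encode (elems (ℱ i)))))
                       (*-monoʳ-< n (large i))
  ranks : ∀ i {A} → A ∈ₗ map encode (elems (ℱ i)) → ∣ A ∣ ≤ suc k
  ranks i A∈ = let x , _ , A≡ = ∈-map⁻ encode A∈ in ≤-reflexive (trans (cong ∣_∣ A≡) (∣encode∣ x))
  main : (∃ λ β → 2 ^ β ≤ suc (suc s) * suc k × suc (suc s) * suc k < 2 ^ suc β) → RainbowMatching ℱ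
  -- Two families and one coordinate already give s k ≥ 2, so the exponent 0 cannot occur.
  main (zero   , _   , sk<2)   = contradiction
    (≤-trans sk<2 (*-mono-≤ {2} {2 + s} {1} (s≤s (s≤s z≤n)) (s≤s z≤n))) (n≮n _)
  main (suc β′ , 2^≤ , sk<2^β) =
    let C , C∈ , C-disjoint = rainbow {s = suc s} {2 + β′} {suc k} {n} {n ^ suc k} (s≤s z≤n) (s≤s z≤n) sk<2^β
          (LogCond⇒4R³≤n² {n} {suc k} {suc (suc s)} logCond β′ 2^≤) 8s²≤n (m^n>0 n (suc k))
          (λ i → map encode (elems (ℱ i))) ranks (λ i → cnt-family≤ (ℱ i)) sizes
    in decode-matching ℱ C∈ C-disjoint
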